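{- Let $k \geq 2$ be an integer. There exist a constant $C = C(k) > 0$ and infinitely many positive integers $N$ such that the number of $k$-dimensional corner-free subsets of $\{1,2,\dots,N\}^k$ is at most $2^{C \cdot c_k(N)}$; that is, the number of such subsets is $2^{O(c_k(N))}$ for infinitely many values of $N$.
   Context: For a positive integer $N$ write $[N]=\{1,2,\dots,N\}$. A $k$-dimensional corner in $[N]^k$ is a set of points of the form $\{\mathbf{a}\}\cup\{\mathbf{a}+de_i : 1\le i\le k\}$ contained in $[N]^k$, for some $\mathbf{a}\in[N]^k$ and integer $d>0$, where $e_1,\dots,e_k$ is the standard basis of $\mathbb{R}^k$. A subset of $[N]^k$ is $k$-dimensional corner-free if it contains no $k$-dimensional corner. $c_k(N)$ denotes the maximum size of a $k$-dimensional corner-free subset of $[N]^k$. -}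

module Defs where

open import Data.Bool using (Bool; true; false; not; _∧_)
open import Data.Nat using (ℕ; zero; suc; _+_; _⊔_)
open import Data.Nat.Properties using () renaming (_≟_ to _≟ℕ_)
open import Data.Fin using (Fin)
open import Data.List using (List; []; _∷_; [_]; map; _++_; concatMap; upTo; filterᵇ; length; foldr; allFin)
open import Data.Bool.ListAction using (any; all)
open import Data.Vec using (Vec; updateAt)
import Data.Vec.Properties as VecP
open import Relation.Nullary.Decidable using (⌊_⌋)

range : ℕ → List ℕ
range N = map suc (upTo N)

points : (k N : ℕ) → List (Vec ℕ k)
points zero    N = [ Data.Vec.[] ]
points (suc k) N = concatMap (λ x → map (x Data.Vec.∷_) (points k N)) (range N)

-- all subsets of a (duplicate-free) list, each subset represented as a sublist
sublists : {A : Set} → List A → List (List A)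
sublists []       = [ [] ]
sublists (x ∷ xs) = sublists xs ++ map (x ∷_) (sublists xs)

_∈ᵇ_ : {k : ℕ} → Vec ℕ k → List (Vec ℕ k) → Bool
v ∈ᵇ S = any (λ w → ⌊ VecP.≡-dec _≟ℕ_ v w ⌋) S

shift : {k : ℕ} → Vec ℕ k → Fin k → ℕ → Vec ℕ k
shift a i d = updateAt a i (_+ d)

isCornerᵇ : {k : ℕ} → List (Vec ℕ k) → Vec ℕ k → ℕ → Bool
isCornerᵇ {k} S a d = (a ∈ᵇ S) ∧ all (λ i → shift a i d ∈ᵇ S) (allFin k)

-- S ⊆ [N]^k contains a k-dimensional corner.  Any corner inside [N]^k has
-- 1 ≤ d ≤ N - 1, so letting d range over [N] loses nothing.
hasCornerᵇ : {k : ℕ} → ℕ → List (Vec ℕ k) → Bool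
hasCornerᵇ N S = any (λ a → any (λ d → isCornerᵇ S a d) (range N)) S

cornerFreeSets : (k N : ℕ) → List (List (Vec ℕ k))
cornerFreeSets k N = filterᵇ (λ S → not (hasCornerᵇ N S)) (sublists (points k N))

numCornerFree : (k N : ℕ) → ℕ
numCornerFree k N = length (cornerFreeSets k N)

c : (k N : ℕ) → ℕ
c k N = foldr _⊔_ 0 (map length (cornerFreeSets k N))

{-# OPTIONS --safe #-}

-- Write d(N) = c_k(N) / N^k.  Behrend's construction gives d(2^(m²)) ≥ 2^(-7m), so along the scales
-- N_j = 2^((βj)²) the density d drops by at most a constant factor between N_{j-1} and N_j for infinitely
-- many j, although Q = N_j / N_{j-1} exceeds any fixed power of 1 / d(N_j) when β is large.  For such j
-- put N = N_j and M = N_{j-1}.  If A ⊆ [N]^k has more than a large constant times c_k(N) points, then for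
-- every q ≤ Q the traces of A on the residue classes mod q, which are copies of pieces of [M]^k, contain
-- a positive proportion of |A| disjoint corners whose difference is divisible by q.  Letting q range over
-- a set of moduli of which only O(log N) can divide a given number below N makes these corners a
-- (k+1)-uniform hypergraph with small codegrees, and a simple container algorithm, which has polynomial
-- losses in d(N) to spare, covers the corner-free sets by 2^(O(c_k(N))) containers of size O(c_k(N)).
module Submission where

open import Defs
open import Data.Bool using (Bool; true; false; not; T; T?)
open import Data.Bool.Properties using (T-∧)
open import Data.Fin using (Fin)
import Data.Fin.Properties as FinP
open import Data.List using (List; []; _∷_; [_]; _++_; map; concat; concatMap; filter; filterᵇ; foldr; take; length; upTo; allFin; cartesianProduct; cartesianProductWith)
open import Data.List.Membership.Propositional using (_∈_; _∉_; lose; find)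
open import Data.List.Membership.Propositional.Properties
open import Data.List.Properties using (filter-all; filter-notAll; filter-++; length-map; length-++; length-take; length-upTo; length-tabulate; ++-identityʳ)
open import Data.List.Relation.Binary.Subset.Propositional using (_⊆_)
open import Data.List.Relation.Unary.All as All using (All; []; _∷_)
import Data.List.Relation.Unary.All.Properties as AllP
open import Data.List.Relation.Unary.AllPairs using ([]; _∷_)
open import Data.List.Relation.Unary.Any as Any using (here; there; any?)
import Data.List.Relation.Unary.Any.Properties as AnyP
open import Data.List.Relation.Unary.Unique.Propositional using (Unique)
import Data.List.Relation.Unary.Unique.Propositional.Properties as UniqueP
open import Data.Nat
open import Data.Nat.Divisibility
open import Data.Nat.DivMod
open import Data.Nat.GCD
open import Data.Nat.LCM
open import Data.Nat.Properties
open import Data.Nat.Tactic.RingSolver using (solve-∀)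
open import Data.Product using (Σ; _×_; _,_; proj₁; proj₂; ∃-syntax)
open import Data.Product.Properties using (≡-dec; ,-injectiveˡ; ,-injectiveʳ)
open import Data.Sum using (_⊎_; inj₁; inj₂)
open import Data.Vec using (Vec; []; _∷_; lookup; zipWith)
import Data.Vec.Properties as VecP
open import Function using (_∘_; id; Equivalence)
open import Level using (0ℓ)
open import Relation.Binary using (DecidableEquality)
open import Relation.Binary.PropositionalEquality hiding ([_])
open import Relation.Nullary using (Dec; yes; no; ¬_; ¬?; contradiction)
open import Relation.Nullary.Decidable using (_×-dec_; toWitness; fromWitness)
open import Relation.Unary using (Pred; Decidable)

-- At N = 2^(m²) the proof knows `c k N` only up to a factor 2^(7m), yet containers must have size
-- O(`c k N`); hence supersaturation compares with `c k M` instead of with an explicit density.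
-- Small codegrees: within the family of one modulus q the corners are disjoint, so two points share
-- at most one of them, and only if they are congruent mod q in every coordinate. Then q divides
-- their l1 distance, a positive number at most k N, so the codegree is O(log N). Degrees can be as
-- large as the number 2^x of moduli, which may be any fixed power of 2^m. This gap pays for the
-- container algorithm: each of the k + 1 rounds selects a proportion 2^(-θ) of the points and
-- lowers the edge size by one. One run of the rounds only removes a proportion 2^(-7m-O(1)) of the
-- grid, so 2^(7m+O(1)) runs are chained; θ is taken so large that all selections together cost at
-- most `c k N` bits. The moduli have size at most 2^(2x+4), and fitting them below Q is what fixes
-- the spacing β = 38k + 59 of the scales.

private variable
  A B : Set

-- Indicator values and finite sums.

⟦_⟧ : {P : Set} → Dec P → ℕ
⟦ yes _ ⟧ = 1
⟦ no  _ ⟧ = 0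

⟦⟧≤1 : {P : Set} (d : Dec P) → ⟦ d ⟧ ≤ 1
⟦⟧≤1 (yes _) = ≤-refl
⟦⟧≤1 (no  _) = z≤n

⟦⟧-yes : {P : Set} (d : Dec P) → P → ⟦ d ⟧ ≡ 1
⟦⟧-yes (yes _) _ = refl
⟦⟧-yes (no ¬p) p = contradiction p ¬p

⟦⟧-no : {P : Set} (d : Dec P) → ¬ P → ⟦ d ⟧ ≡ 0
⟦⟧-no (yes p) ¬p = contradiction p ¬p
⟦⟧-no (no  _) _  = refl

⟦⟧-mono : {P Q : Set} (d : Dec P) (e : Dec Q) → (P → Q) → ⟦ d ⟧ ≤ ⟦ e ⟧
⟦⟧-mono (yes p) e f = ≤-reflexive (sym (⟦⟧-yes e (f p)))
⟦⟧-mono (no  _) e f = z≤n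

∑ : List A → (A → ℕ) → ℕ
∑ []       f = 0
∑ (x ∷ xs) f = f x + ∑ xs f

∑-mono : ∀ (xs : List A) {f g : A → ℕ} → (∀ {x} → x ∈ xs → f x ≤ g x) → ∑ xs f ≤ ∑ xs g
∑-mono []       h = z≤n
∑-mono (x ∷ xs) h = +-mono-≤ (h (here refl)) (∑-mono xs (h ∘ there))

∑-cong : ∀ (xs : List A) {f g : A → ℕ} → (∀ x → f x ≡ g x) → ∑ xs f ≡ ∑ xs g
∑-cong []       h = refl
∑-cong (x ∷ xs) h = cong₂ _+_ (h x) (∑-cong xs h)

∑-const : ∀ (xs : List A) c → ∑ xs (λ _ → c) ≡ length xs * c
∑-const []       c = refl
∑-const (x ∷ xs) c = cong (c +_) (∑-const xs c)

∑-+ : ∀ (xs : List A) (f g : A → ℕ) → ∑ xs (λ x → f x + g x) ≡ ∑ xs f + ∑ xs g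
∑-+ []       f g = refl
∑-+ (x ∷ xs) f g = trans (cong (f x + g x +_) (∑-+ xs f g)) (interchange (f x) (g x) _ _)
  where
  interchange : ∀ a b c d → a + b + (c + d) ≡ a + c + (b + d)
  interchange = solve-∀

∑-*ˡ : ∀ (xs : List A) c (f : A → ℕ) → ∑ xs (λ x → c * f x) ≡ c * ∑ xs f
∑-*ˡ []       c f = sym (*-zeroʳ c)
∑-*ˡ (x ∷ xs) c f = trans (cong (c * f x +_) (∑-*ˡ xs c f)) (sym (*-distribˡ-+ c (f x) _))

∑-*ʳ : ∀ (xs : List A) c (f : A → ℕ) → ∑ xs (λ x → f x * c) ≡ ∑ xs f * c
∑-*ʳ xs c f = trans (∑-cong xs (λ x → *-comm (f x) c)) (trans (∑-*ˡ xs c f) (*-comm c _))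

∑-swap : ∀ (xs : List A) (ys : List B) (f : A → B → ℕ) →
  ∑ xs (λ x → ∑ ys (f x)) ≡ ∑ ys (λ y → ∑ xs (λ x → f x y))
∑-swap []       ys f = sym (trans (∑-const ys 0) (*-zeroʳ (length ys)))
∑-swap (x ∷ xs) ys f = trans (cong (∑ ys (f x) +_) (∑-swap xs ys f)) (sym (∑-+ ys (f x) _))

∑-++ : ∀ (xs ys : List A) (f : A → ℕ) → ∑ (xs ++ ys) f ≡ ∑ xs f + ∑ ys f
∑-++ []       ys f = refl
∑-++ (x ∷ xs) ys f = trans (cong (f x +_) (∑-++ xs ys f)) (sym (+-assoc (f x) _ _))

∑-map : ∀ (g : A → B) (xs : List A) (f : B → ℕ) → ∑ (map g xs) f ≡ ∑ xs (f ∘ g)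
∑-map g []       f = refl
∑-map g (x ∷ xs) f = cong (f (g x) +_) (∑-map g xs f)

∑-concat : ∀ (xss : List (List A)) (f : A → ℕ) → ∑ (concat xss) f ≡ ∑ xss (λ xs → ∑ xs f)
∑-concat []         f = refl
∑-concat (xs ∷ xss) f = trans (∑-++ xs (concat xss) f) (cong (∑ xs f +_) (∑-concat xss f))

∑-filter : {P : Pred A 0ℓ} (P? : Decidable P) (xs : List A) (f : A → ℕ) →
  ∑ (filter P? xs) f ≡ ∑ xs (λ x → ⟦ P? x ⟧ * f x)
∑-filter P? []       f = refl
∑-filter P? (x ∷ xs) f with P? x
... | yes _ = cong₂ _+_ (sym (+-identityʳ (f x))) (∑-filter P? xs f)
... | no  _ = ∑-filter P? xs f

∑-take : ∀ n (xs : List A) (f : A → ℕ) → ∑ (take n xs) f ≤ ∑ xs f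
∑-take zero    xs       f = z≤n
∑-take (suc n) []       f = z≤n
∑-take (suc n) (x ∷ xs) f = +-monoʳ-≤ (f x) (∑-take n xs f)

∈⇒≤∑ : ∀ {xs : List A} {x} (f : A → ℕ) → x ∈ xs → f x ≤ ∑ xs f
∈⇒≤∑ f (here refl) = m≤m+n _ _
∈⇒≤∑ f (there x∈)  = m≤n⇒m≤o+n _ (∈⇒≤∑ f x∈)

length≡∑ : (xs : List A) → length xs ≡ ∑ xs (λ _ → 1)
length≡∑ xs = sym (trans (∑-const xs 1) (*-identityʳ _))

length-filter≡∑ : {P : Pred A 0ℓ} (P? : Decidable P) (xs : List A) →
  length (filter P? xs) ≡ ∑ xs (λ x → ⟦ P? x ⟧)
length-filter≡∑ P? xs = trans (length≡∑ (filter P? xs))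
  (trans (∑-filter P? xs _) (∑-cong xs (λ x → *-identityʳ _)))

∑<⇒∃< : ∀ (xs : List A) (f g : A → ℕ) → ∑ xs g < ∑ xs f → ∃[ x ] x ∈ xs × g x < f x
∑<⇒∃< (x ∷ xs) f g lt with g x <? f x
... | yes gx<fx = x , here refl , gx<fx
... | no  gx≮fx with ∑<⇒∃< xs f g (+-cancelˡ-< (g x) _ _ (<-≤-trans lt (+-monoˡ-≤ _ (≮⇒≥ gx≮fx))))
... | y , y∈ , h = y , there y∈ , h

∑-pigeonhole : ∀ (xs : List A) (f : A → ℕ) {n w} → 0 < n → 0 < w →
  length xs ≤ n → n * w ≤ ∑ xs f → ∃[ x ] x ∈ xs × w ≤ f x
∑-pigeonhole xs f {n} {suc w} 0<n _ len≤ le = ∑<⇒∃< xs f (λ _ → w) (begin-strict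
  ∑ xs (λ _ → w) ≡⟨ ∑-const xs w ⟩
  length xs * w  ≤⟨ *-monoˡ-≤ w len≤ ⟩
  n * w          <⟨ *-monoʳ-< n {{>-nonZero 0<n}} (n<1+n w) ⟩
  n * suc w      ≤⟨ le ⟩
  ∑ xs f         ∎)
  where open ≤-Reasoning

-- Lists without repetition as finite sets.

module UniqueLists {V : Set} (_≟_ : DecidableEquality V) where
  open import Data.List.Membership.DecPropositional _≟_ using (_∈?_) public

  infixl 6 _∖_

  _∖_ : List V → V → List V
  xs ∖ v = filter (λ u → ¬? (u ≟ v)) xs

  ∑-≟≤1 : ∀ {xs} x → Unique xs → ∑ xs (λ u → ⟦ u ≟ x ⟧) ≤ 1
  ∑-≟≤1 x [] = z≤n
  ∑-≟≤1 {y ∷ ys} x (y∉ ∷ uniq) with y ≟ x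
  ... | no  _    = ∑-≟≤1 x uniq
  ... | yes refl = ≤-reflexive (cong suc (≤-antisym
    (≤-trans (∑-mono ys {g = λ _ → 0} λ {u} u∈ → ≤-reflexive (⟦⟧-no (u ≟ x)
      λ u≡x → All.lookup y∉ u∈ (sym u≡x))) (≤-reflexive (trans (∑-const ys 0) (*-zeroʳ (length ys))))) z≤n))

  ∑-∈?≤length : ∀ {xs} (e : List V) → Unique xs → ∑ xs (λ u → ⟦ u ∈? e ⟧) ≤ length e
  ∑-∈?≤length {xs} [] uniq = ≤-reflexive (trans (∑-cong xs (λ u → ⟦⟧-no (u ∈? []) λ ()))
    (trans (∑-const xs 0) (*-zeroʳ (length xs))))
  ∑-∈?≤length {xs} (x ∷ e) uniq = begin
    ∑ xs (λ u → ⟦ u ∈? (x ∷ e) ⟧)                    ≤⟨ ∑-mono xs (λ {u} _ → split u) ⟩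
    ∑ xs (λ u → ⟦ u ≟ x ⟧ + ⟦ u ∈? e ⟧)              ≡⟨ ∑-+ xs _ _ ⟩
    ∑ xs (λ u → ⟦ u ≟ x ⟧) + ∑ xs (λ u → ⟦ u ∈? e ⟧) ≤⟨ +-mono-≤ (∑-≟≤1 x uniq) (∑-∈?≤length e uniq) ⟩
    suc (length e)                                   ∎
    where
    open ≤-Reasoning
    split : ∀ u → ⟦ u ∈? (x ∷ e) ⟧ ≤ ⟦ u ≟ x ⟧ + ⟦ u ∈? e ⟧
    split u with u ≟ x | u ∈? (x ∷ e)
    ... | yes _ | d             = ≤-trans (⟦⟧≤1 d) (m≤m+n 1 _)
    ... | no _  | no _          = z≤n
    ... | no u≢ | yes (here eq) = contradiction eq u≢
    ... | no _  | yes (there i) = ≤-reflexive (sym (⟦⟧-yes (u ∈? e) i))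

  ∑-≟≤∈? : ∀ {xs} y → Unique xs → ∑ xs (λ x → ⟦ x ≟ y ⟧) ≤ ⟦ y ∈? xs ⟧
  ∑-≟≤∈? {xs} y uniq with y ∈? xs
  ... | yes _  = ∑-≟≤1 y uniq
  ... | no  y∉ = ≤-trans (∑-mono xs {g = λ _ → 0} (λ {x} x∈ → ≤-reflexive (⟦⟧-no (x ≟ y) λ { refl → y∉ x∈ })))
                   (≤-reflexive (trans (∑-const xs 0) (*-zeroʳ (length xs))))

  length≤∑-∈? : ∀ {xs ys} → Unique xs → xs ⊆ ys → length xs ≤ ∑ ys (λ u → ⟦ u ∈? xs ⟧)
  length≤∑-∈? {xs} {ys} uniq sub = begin
    length xs                              ≡⟨ length≡∑ xs ⟩
    ∑ xs (λ _ → 1)                         ≤⟨ ∑-mono xs (λ {x} x∈ →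
      ≤-trans (≤-reflexive (sym (⟦⟧-yes (x ≟ x) refl))) (∈⇒≤∑ (λ y → ⟦ x ≟ y ⟧) (sub x∈))) ⟩
    ∑ xs (λ x → ∑ ys (λ y → ⟦ x ≟ y ⟧))    ≡⟨ ∑-swap xs ys _ ⟩
    ∑ ys (λ y → ∑ xs (λ x → ⟦ x ≟ y ⟧))    ≤⟨ ∑-mono ys (λ {y} _ → ∑-≟≤∈? y uniq) ⟩
    ∑ ys (λ u → ⟦ u ∈? xs ⟧)               ∎
    where
    open ≤-Reasoning

  ∖-⊆ : ∀ xs {v} → xs ∖ v ⊆ xs
  ∖-⊆ xs u∈ = proj₁ (∈-filter⁻ (λ u → ¬? (u ≟ _)) {xs = xs} u∈)

  ∉-∖ : ∀ xs v → v ∉ xs ∖ v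
  ∉-∖ xs v v∈ = proj₂ (∈-filter⁻ (λ u → ¬? (u ≟ v)) {xs = xs} v∈) refl

  ∈-∖ : ∀ {xs u v} → u ∈ xs → u ≢ v → u ∈ xs ∖ v
  ∈-∖ u∈ u≢v = ∈-filter⁺ (λ u → ¬? (u ≟ _)) u∈ u≢v

  length-∖ : ∀ {xs v} → v ∈ xs → length (xs ∖ v) < length xs
  length-∖ {xs} v∈ = filter-notAll (λ u → ¬? (u ≟ _)) xs (Any.map (λ v≡u u≢v → u≢v (sym v≡u)) v∈)

∈-take : {A : Set} (n : ℕ) {xs : List A} {x : A} → x ∈ take n xs → x ∈ xs
∈-take (suc n) {y ∷ xs} (here eq)  = here eq
∈-take (suc n) {y ∷ xs} (there x∈) = there (∈-take n x∈)

-- One round of the container algorithm.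

module Containers {V : Set} (_≟_ : DecidableEquality V)
  (P : List V → Set) (P? : Decidable P)
  (antitone : ∀ {S S'} → S ⊆ S' → P S' → P S) where

  open UniqueLists _≟_

  -- For unique A, the number of S ⊆ A such that S ∪ T satisfies P.
  cnt : List V → List V → ℕ
  cnt []      T = ⟦ P? T ⟧
  cnt (x ∷ A) T = cnt A T + cnt A (x ∷ T)

  ∷-⊆ : ∀ {x : V} {S S'} → S ⊆ S' → x ∷ S ⊆ x ∷ S'
  ∷-⊆ sub (here eq) = here eq
  ∷-⊆ sub (there i) = there (sub i)

  cnt-antitone : ∀ A {T T'} → T ⊆ T' → cnt A T' ≤ cnt A T
  cnt-antitone []      sub = ⟦⟧-mono (P? _) (P? _) (antitone sub)
  cnt-antitone (x ∷ A) sub = +-mono-≤ (cnt-antitone A sub) (cnt-antitone A (∷-⊆ sub))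

  cnt≤2^ : ∀ A T → cnt A T ≤ 2 ^ length A
  cnt≤2^ []      T = ⟦⟧≤1 (P? T)
  cnt≤2^ (x ∷ A) T = subst (cnt (x ∷ A) T ≤_) (cong (2 ^ length A +_) (sym (+-identityʳ _)))
    (+-mono-≤ (cnt≤2^ A T) (cnt≤2^ A (x ∷ T)))

  ¬P⇒cnt≤ : ∀ A {T} {m} → ¬ P T → cnt A T ≤ m
  ¬P⇒cnt≤ A {T} {m} ¬p = subst (_≤ m) (sym (zer A ¬p)) z≤n
    where
    zer : ∀ A {T} → ¬ P T → cnt A T ≡ 0
    zer []      ¬p = ⟦⟧-no (P? _) ¬p
    zer (x ∷ A) ¬p = cong₂ _+_ (zer A ¬p) (zer A (¬p ∘ antitone there))

  -- `cnt` branches only at the head of the list, while the algorithm branches at a vertex of its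
  -- choice. The two branchings commute because `P` depends only on the set of elements of `T`.
  cnt-query : ∀ {A v} T → Unique A → v ∈ A → cnt A T ≤ cnt (A ∖ v) T + cnt (A ∖ v) (v ∷ T)
  cnt-query {x ∷ A} {v} T (x∉ ∷ uniq) v∈ with x ≟ v
  ... | yes refl = ≤-reflexive (cong (λ B → cnt B T + cnt B (x ∷ T))
          (sym (filter-all (λ u → ¬? (u ≟ x)) (All.map (λ x≢u u≡x → x≢u (sym u≡x)) x∉))))
  ... | no x≢v with v∈
  ...   | here v≡x  = contradiction (sym v≡x) x≢v
  ...   | there v∈A = begin
    cnt A T + cnt A (x ∷ T)
      ≤⟨ +-mono-≤ (cnt-query T uniq v∈A) (cnt-query (x ∷ T) uniq v∈A) ⟩
    (cnt (A ∖ v) T + cnt (A ∖ v) (v ∷ T)) + (cnt (A ∖ v) (x ∷ T) + cnt (A ∖ v) (v ∷ x ∷ T))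
      ≤⟨ +-monoʳ-≤ (cnt (A ∖ v) T + cnt (A ∖ v) (v ∷ T)) (+-monoʳ-≤ (cnt (A ∖ v) (x ∷ T)) (cnt-antitone (A ∖ v) swap)) ⟩
    (cnt (A ∖ v) T + cnt (A ∖ v) (v ∷ T)) + (cnt (A ∖ v) (x ∷ T) + cnt (A ∖ v) (x ∷ v ∷ T))
      ≡⟨ interchange (cnt (A ∖ v) T) _ _ _ ⟩
    (cnt (A ∖ v) T + cnt (A ∖ v) (x ∷ T)) + (cnt (A ∖ v) (v ∷ T) + cnt (A ∖ v) (x ∷ v ∷ T)) ∎
    where
    open ≤-Reasoning
    interchange : ∀ a b c d → a + b + (c + d) ≡ a + c + (b + d)
    interchange = solve-∀
    swap : x ∷ v ∷ T ⊆ v ∷ x ∷ T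
    swap (here eq)         = there (here eq)
    swap (there (here eq)) = here eq
    swap (there (there i)) = there (there i)

  deg : List (List V) → V → ℕ
  deg H v = ∑ H (λ e → ⟦ v ∈? e ⟧)

  codeg : List (List V) → V → V → ℕ
  codeg H u v = ∑ H (λ e → ⟦ u ∈? e ⟧ * ⟦ v ∈? e ⟧)

  -- An edge not contained in `B` is charged to one of its vertices outside `B`.
  length≤filter+∑deg : ∀ {A₀} H {B : Pred V 0ℓ} (B? : Decidable B) →
    (∀ {e} → e ∈ H → e ⊆ A₀) →
    length H ≤ length (filter (All.all? B?) H) + ∑ A₀ (λ u → ⟦ ¬? (B? u) ⟧ * deg H u)
  length≤filter+∑deg {A₀} H B? inside = begin
    length H
      ≡⟨ length≡∑ H ⟩
    ∑ H (λ _ → 1)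
      ≤⟨ ∑-mono H one ⟩
    ∑ H (λ e → ⟦ All.all? B? e ⟧ + ∑ A₀ (λ u → ⟦ ¬? (B? u) ⟧ * ⟦ u ∈? e ⟧))
      ≡⟨ ∑-+ H _ _ ⟩
    ∑ H (λ e → ⟦ All.all? B? e ⟧) + ∑ H (λ e → ∑ A₀ (λ u → ⟦ ¬? (B? u) ⟧ * ⟦ u ∈? e ⟧))
      ≡⟨ cong₂ _+_ (sym (length-filter≡∑ (All.all? B?) H)) (∑-swap H A₀ _) ⟩
    length (filter (All.all? B?) H) + ∑ A₀ (λ u → ∑ H (λ e → ⟦ ¬? (B? u) ⟧ * ⟦ u ∈? e ⟧))
      ≡⟨ cong (length (filter (All.all? B?) H) +_) (∑-cong A₀ (λ u → ∑-*ˡ H ⟦ ¬? (B? u) ⟧ _)) ⟩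
    length (filter (All.all? B?) H) + ∑ A₀ (λ u → ⟦ ¬? (B? u) ⟧ * deg H u) ∎
    where
    open ≤-Reasoning
    one : ∀ {e} → e ∈ H → 1 ≤ ⟦ All.all? B? e ⟧ + ∑ A₀ (λ u → ⟦ ¬? (B? u) ⟧ * ⟦ u ∈? e ⟧)
    one {e} e∈ with All.all? B? e
    ... | yes _ = s≤s z≤n
    ... | no ¬all with find (AllP.¬All⇒Any¬ B? e ¬all)
    ... | u , u∈e , ¬Bu = ≤-trans
      (≤-reflexive (sym (cong₂ _*_ (⟦⟧-yes (¬? (B? u)) ¬Bu) (⟦⟧-yes (u ∈? e) u∈e))))
      (∈⇒≤∑ (λ u → ⟦ ¬? (B? u) ⟧ * ⟦ u ∈? e ⟧) (inside e∈ u∈e))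

  length+∑-∉≤ : ∀ {A A₀} → Unique A → A ⊆ A₀ →
    length A + ∑ A₀ (λ u → ⟦ ¬? (u ∈? A) ⟧) ≤ length A₀
  length+∑-∉≤ {A} {A₀} uniq sub = begin
    length A + ∑ A₀ (λ u → ⟦ ¬? (u ∈? A) ⟧)
      ≤⟨ +-monoˡ-≤ _ (length≤∑-∈? uniq sub) ⟩
    ∑ A₀ (λ u → ⟦ u ∈? A ⟧) + ∑ A₀ (λ u → ⟦ ¬? (u ∈? A) ⟧)
      ≡⟨ sym (∑-+ A₀ _ _) ⟩
    ∑ A₀ (λ u → ⟦ u ∈? A ⟧ + ⟦ ¬? (u ∈? A) ⟧)
      ≤⟨ ∑-mono A₀ (λ {u} _ → excl u) ⟩
    ∑ A₀ (λ _ → 1)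
      ≡⟨ sym (length≡∑ A₀) ⟩
    length A₀ ∎
    where
    open ≤-Reasoning
    excl : ∀ u → ⟦ u ∈? A ⟧ + ⟦ ¬? (u ∈? A) ⟧ ≤ 1
    excl u with u ∈? A
    ... | yes _ = ≤-refl
    ... | no  _ = ≤-refl

  ∑deg≤ : ∀ {A₀} r G → Unique A₀ → (∀ {e} → e ∈ G → length e ≤ r) → ∑ A₀ (deg G) ≤ length G * r
  ∑deg≤ {A₀} r G uniq short = begin
    ∑ A₀ (deg G)                          ≡⟨ ∑-swap A₀ G _ ⟩
    ∑ G (λ e → ∑ A₀ (λ u → ⟦ u ∈? e ⟧))   ≤⟨ ∑-mono G (λ {e} e∈ → ≤-trans (∑-∈?≤length e uniq) (short e∈)) ⟩
    ∑ G (λ _ → r)                         ≡⟨ ∑-const G r ⟩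
    length G * r                          ∎
    where open ≤-Reasoning

  avoid⇒deg≡0 : ∀ H u → (∀ {e} → e ∈ H → u ∉ e) → deg H u ≤ 0
  avoid⇒deg≡0 H u avoid = ≤-trans
    (∑-mono H {g = λ _ → 0} (λ {e} e∈ → ≤-reflexive (⟦⟧-no (u ∈? e) (avoid e∈))))
    (≤-reflexive (trans (∑-const H 0) (*-zeroʳ (length H))))

  -- Edges form a list, so they count with multiplicity. `T` holds the vertices already known to be
  -- chosen; by `bad`, no set counted by `cnt A T` contains an edge.
  record Hypergraph (A₀ T : List V) (r : ℕ) (H : List (List V)) : Set where
    field
      short  : ∀ {e} → e ∈ H → length e ≤ r
      inside : ∀ {e} → e ∈ H → e ⊆ A₀
      bad    : ∀ {e} → e ∈ H → ¬ P (e ++ T)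

  open Hypergraph

  -- One round of the container algorithm.  Query vertices of large degree: a vertex outside the
  -- counted set is deleted, and t vertices inside it contribute w link edges each to G, whose edges
  -- have size at most r.  Edges through a vertex of G-degree ≥ cap are no longer used, so that the
  -- degrees in G stay bounded; at most S vertices are lost in this way.  If s vertices are deleted
  -- before t have been chosen, finish applies.
  module Phase {A₀ T₀ : List V} (uniq₀ : Unique A₀) {r Δ K w t cap S s n Y Z : ℕ}
    {H₀ : List (List V)} (hyp₀ : Hypergraph A₀ T₀ (suc r) H₀)
    (deg₀ : ∀ v → deg H₀ v ≤ Δ)
    (0<n : 0 < n) (0<w : 0 < w) (0<cap : 0 < cap) (A₀≤n : length A₀ ≤ n)
    (many : Δ * s + Δ * S + n * w ≤ length H₀)
    (cap≥ : w * t * r ≤ S * cap)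
    (Y≤Z : Y ≤ Z)
    (finish : ∀ {A T} → Unique A → A ⊆ A₀ → length A + s ≤ length A₀ → cnt A T ≤ Y)
    (next : ∀ {A T G} → Unique A → A ⊆ A₀ → Hypergraph A₀ T r G →
            (∀ v → deg G v ≤ cap + K) → (∀ {u v} → u ≢ v → codeg G u v ≤ K) →
            w * t ≤ length G → cnt A T ≤ Z)
    where

    alive : List V → List (List V)
    alive A = filter (All.all? (_∈? A)) H₀

    Free : List V → List (List V) → V → Set
    Free A G u = u ∈ A × deg G u < cap

    free? : ∀ A G → Decidable (Free A G)
    free? A G u = (u ∈? A) ×-dec (deg G u <? cap)

    usable : List V → List (List V) → List (List V)
    usable A G = filter (All.all? (free? A G)) H₀

    -- The codegrees of G and of the surviving part of H₀ are bounded jointly because a chosen vertex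
    -- is deleted, so that every edge of H₀ contributes to G at most once.
    record State (A T : List V) (G : List (List V)) (τ : ℕ) : Set where
      field
        uniq   : Unique A
        sub    : A ⊆ A₀
        T₀⊆T   : T₀ ⊆ T
        hyp    : Hypergraph A₀ T r G
        deg≤   : ∀ v → deg G v ≤ cap + K
        codeg≤ : ∀ {u v} → u ≢ v → codeg G u v + codeg (alive A) u v ≤ K
        size   : length G + w * τ ≡ w * t

    open State

    -- Markov's inequality: `size` caps the number of edges of `G`, so its degrees add up to at most
    -- `w * t * r`.
    saturated≤ : ∀ {A T G τ} → State A T G τ → ∑ A₀ (λ u → ⟦ ¬? (deg G u <? cap) ⟧) ≤ S
    saturated≤ {G = G} {τ} st = *-cancelʳ-≤ _ S cap {{>-nonZero 0<cap}} (begin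
      ∑ A₀ (λ u → ⟦ ¬? (deg G u <? cap) ⟧) * cap ≡⟨ sym (∑-*ʳ A₀ cap _) ⟩
      ∑ A₀ (λ u → ⟦ ¬? (deg G u <? cap) ⟧ * cap) ≤⟨ ∑-mono A₀ (λ {u} _ → markov u) ⟩
      ∑ A₀ (deg G)                                ≤⟨ ∑deg≤ r G uniq₀ (short (hyp st)) ⟩
      length G * r                                ≤⟨ *-monoˡ-≤ r (≤-trans (m≤m+n (length G) (w * τ)) (≤-reflexive (size st))) ⟩
      w * t * r                                   ≤⟨ cap≥ ⟩
      S * cap                                     ∎)
      where
      open ≤-Reasoning
      markov : ∀ u → ⟦ ¬? (deg G u <? cap) ⟧ * cap ≤ deg G u
      markov u with deg G u <? cap
      ... | yes _ = z≤n
      ... | no ¬< = ≤-trans (≤-reflexive (+-identityʳ cap)) (≮⇒≥ ¬<)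

    -- An edge becomes unusable through a deleted vertex, of which there are at most `s`, or a
    -- saturated one, of which there are at most `S`; each spoils at most `Δ` edges.
    usable≥ : ∀ {A T G τ} → State A T G τ → length A₀ < length A + s → n * w ≤ length (usable A G)
    usable≥ {A} {T} {G} st A₀<A+s = +-cancelˡ-≤ (Δ * s + Δ * S) _ _ (begin
      Δ * s + Δ * S + n * w
        ≤⟨ many ⟩
      length H₀
        ≤⟨ length≤filter+∑deg H₀ (free? A G) (inside hyp₀) ⟩
      length (usable A G) + ∑ A₀ (λ u → ⟦ ¬? (free? A G u) ⟧ * deg H₀ u)
        ≤⟨ +-monoʳ-≤ _ (∑-mono A₀ (λ {u} _ → *-mono-≤ (split u) (deg₀ u))) ⟩
      length (usable A G) + ∑ A₀ (λ u → (⟦ ¬? (u ∈? A) ⟧ + ⟦ ¬? (deg G u <? cap) ⟧) * Δ)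
        ≡⟨ cong (length (usable A G) +_) (trans (∑-*ʳ A₀ Δ _) (cong (_* Δ) (∑-+ A₀ _ _))) ⟩
      length (usable A G) + (∑ A₀ (λ u → ⟦ ¬? (u ∈? A) ⟧) + ∑ A₀ (λ u → ⟦ ¬? (deg G u <? cap) ⟧)) * Δ
        ≤⟨ +-monoʳ-≤ _ (*-monoˡ-≤ Δ (+-mono-≤ dead≤s (saturated≤ st))) ⟩
      length (usable A G) + (s + S) * Δ
        ≡⟨ rearrange (length (usable A G)) s S Δ ⟩
      Δ * s + Δ * S + length (usable A G) ∎)
      where
      open ≤-Reasoning
      rearrange : ∀ h s S Δ → h + (s + S) * Δ ≡ Δ * s + Δ * S + h
      rearrange = solve-∀
      dead≤s : ∑ A₀ (λ u → ⟦ ¬? (u ∈? A) ⟧) ≤ s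
      dead≤s = +-cancelˡ-≤ (length A) _ _ (≤-trans (length+∑-∉≤ (uniq st) (sub st)) (<⇒≤ A₀<A+s))
      split : ∀ u → ⟦ ¬? (free? A G u) ⟧ ≤ ⟦ ¬? (u ∈? A) ⟧ + ⟦ ¬? (deg G u <? cap) ⟧
      split u with u ∈? A | deg G u <? cap
      ... | yes _ | yes _ = z≤n
      ... | yes _ | no _  = ≤-refl
      ... | no _  | yes _ = ≤-refl
      ... | no _  | no _  = s≤s z≤n

    -- Averaging over at most `n` vertices. A usable edge does have a vertex: an empty bad edge
    -- would mean that `T₀` violates `P`, and then so would `T`.
    pivot : ∀ {A T G τ} → State A T G τ → length A₀ < length A + s → P T →
            ∃[ v ] v ∈ A × w ≤ deg (usable A G) v
    pivot {A} {T} {G} st A₀<A+s PT = ∑-pigeonhole A (deg (usable A G)) 0<n 0<w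
      (≤-trans (≤-trans (m≤m+n _ _) (length+∑-∉≤ (uniq st) (sub st))) A₀≤n)
      (begin
      n * w                                        ≤⟨ usable≥ st A₀<A+s ⟩
      length (usable A G)                          ≡⟨ length≡∑ (usable A G) ⟩
      ∑ (usable A G) (λ _ → 1)                     ≤⟨ ∑-mono (usable A G) one ⟩
      ∑ (usable A G) (λ e → ∑ A (λ v → ⟦ v ∈? e ⟧)) ≡⟨ ∑-swap (usable A G) A _ ⟩
      ∑ A (deg (usable A G))                       ∎)
      where
      open ≤-Reasoning
      one : ∀ {e} → e ∈ usable A G → 1 ≤ ∑ A (λ v → ⟦ v ∈? e ⟧)
      one {e} e∈ with ∈-filter⁻ (All.all? (free? A G)) {xs = H₀} e∈
      one {[]}    e∈ | e∈H₀ , _          = contradiction (antitone (T₀⊆T st) PT) (bad hyp₀ e∈H₀)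
      one {x ∷ e} e∈ | e∈H₀ , (x∈A , _) ∷ _ = ≤-trans
        (≤-reflexive (sym (⟦⟧-yes (x ∈? (x ∷ e)) (here refl)))) (∈⇒≤∑ (λ v → ⟦ v ∈? (x ∷ e) ⟧) x∈A)

    alive-∖ : ∀ A v {u u'} → codeg (alive (A ∖ v)) u u' ≤ codeg (alive A) u u'
    alive-∖ A v = subst₂ _≤_ (sym (∑-filter _ H₀ _)) (sym (∑-filter _ H₀ _))
      (∑-mono H₀ λ {e} _ → *-monoˡ-≤ _
        (⟦⟧-mono (All.all? (_∈? (A ∖ v)) e) (All.all? (_∈? A) e) (All.map (∖-⊆ A))))

    decline : ∀ {A T G τ v} → State A T G τ → State (A ∖ v) T G τ
    decline {A} {v = v} st = record
      { uniq   = UniqueP.filter⁺ _ (uniq st)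
      ; sub    = sub st ∘ ∖-⊆ A
      ; T₀⊆T   = T₀⊆T st
      ; hyp    = hyp st
      ; deg≤   = deg≤ st
      ; codeg≤ = λ u≢v → ≤-trans (+-monoʳ-≤ _ (alive-∖ A v)) (codeg≤ st u≢v)
      ; size   = size st
      }

    links : List V → List (List V) → V → List (List V)
    links A G v = map (_∖ v) (filter (v ∈?_) (usable A G))

    ∑-links : ∀ A G v f → ∑ (links A G v) f
            ≡ ∑ H₀ (λ e → ⟦ All.all? (free? A G) e ⟧ * (⟦ v ∈? e ⟧ * f (e ∖ v)))
    ∑-links A G v f = trans (∑-map (_∖ v) (filter (v ∈?_) (usable A G)) f)
      (trans (∑-filter (v ∈?_) (usable A G) _) (∑-filter (All.all? (free? A G)) H₀ _))

    ∈-links : ∀ A G v {e'} → e' ∈ links A G v →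
      ∃[ e ] e ∈ H₀ × All (Free A G) e × v ∈ e × e' ≡ e ∖ v
    ∈-links A G v e'∈ with ∈-map⁻ (_∖ v) e'∈
    ... | e , e∈ , eq with ∈-filter⁻ (v ∈?_) {xs = usable A G} e∈
    ...   | e∈u , v∈e with ∈-filter⁻ (All.all? (free? A G)) {xs = H₀} e∈u
    ...     | e∈H₀ , free = e , e∈H₀ , free , v∈e , eq

    ⟦∈∖⟧≤ : ∀ e u v → ⟦ u ∈? (e ∖ v) ⟧ ≤ ⟦ u ∈? e ⟧
    ⟦∈∖⟧≤ e u v = ⟦⟧-mono (u ∈? (e ∖ v)) (u ∈? e) (∖-⊆ e)

    -- An edge through `v` may enter the links but dies with `v`; an edge avoiding `v` yields no
    -- link. So no edge is counted twice on the left.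
    codeg-links : ∀ A G v {u u'} →
      codeg (links A G v) u u' + codeg (alive (A ∖ v)) u u' ≤ codeg (alive A) u u'
    codeg-links A G v {u} {u'} = subst₂ _≤_
      (trans (∑-+ H₀ _ _) (cong₂ _+_ (sym (∑-links A G v _)) (sym (∑-filter _ H₀ _))))
      (sym (∑-filter _ H₀ _))
      (∑-mono H₀ λ {e} _ → term e)
      where
      open ≤-Reasoning
      term : ∀ e →
        ⟦ All.all? (free? A G) e ⟧ * (⟦ v ∈? e ⟧ * (⟦ u ∈? (e ∖ v) ⟧ * ⟦ u' ∈? (e ∖ v) ⟧))
          + ⟦ All.all? (_∈? (A ∖ v)) e ⟧ * (⟦ u ∈? e ⟧ * ⟦ u' ∈? e ⟧)
        ≤ ⟦ All.all? (_∈? A) e ⟧ * (⟦ u ∈? e ⟧ * ⟦ u' ∈? e ⟧)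
      term e with v ∈? e
      ... | no _ = +-mono-≤ (≤-reflexive (*-zeroʳ ⟦ All.all? (free? A G) e ⟧))
        (*-monoˡ-≤ (⟦ u ∈? e ⟧ * ⟦ u' ∈? e ⟧) (⟦⟧-mono (All.all? (_∈? (A ∖ v)) e) (All.all? (_∈? A) e) (All.map (∖-⊆ A))))
      ... | yes v∈e = begin
        ⟦ All.all? (free? A G) e ⟧ * (1 * (⟦ u ∈? (e ∖ v) ⟧ * ⟦ u' ∈? (e ∖ v) ⟧))
          + ⟦ All.all? (_∈? (A ∖ v)) e ⟧ * (⟦ u ∈? e ⟧ * ⟦ u' ∈? e ⟧)
          ≡⟨ cong₂ _+_ (cong (⟦ All.all? (free? A G) e ⟧ *_) (*-identityˡ _))
               (cong (_* _) (⟦⟧-no (All.all? (_∈? (A ∖ v)) e) λ all → ∉-∖ A v (All.lookup all v∈e))) ⟩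
        ⟦ All.all? (free? A G) e ⟧ * (⟦ u ∈? (e ∖ v) ⟧ * ⟦ u' ∈? (e ∖ v) ⟧) + 0
          ≡⟨ +-identityʳ _ ⟩
        ⟦ All.all? (free? A G) e ⟧ * (⟦ u ∈? (e ∖ v) ⟧ * ⟦ u' ∈? (e ∖ v) ⟧)
          ≤⟨ *-mono-≤ (⟦⟧-mono (All.all? (free? A G) e) (All.all? (_∈? A) e) (All.map proj₁))
                      (*-mono-≤ (⟦∈∖⟧≤ e u v) (⟦∈∖⟧≤ e u' v)) ⟩
        ⟦ All.all? (_∈? A) e ⟧ * (⟦ u ∈? e ⟧ * ⟦ u' ∈? e ⟧) ∎

    -- A link edge through `u` comes from an edge through both `u` and `v`.
    deg-links-codeg : ∀ A G u v → deg (links A G v) u ≤ codeg (alive A) u v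
    deg-links-codeg A G u v = subst₂ _≤_ (sym (∑-links A G v _)) (sym (∑-filter _ H₀ _))
      (∑-mono H₀ λ {e} _ → *-mono-≤
        (⟦⟧-mono (All.all? (free? A G) e) (All.all? (_∈? A) e) (All.map proj₁))
        (≤-trans (*-monoʳ-≤ ⟦ v ∈? e ⟧ (⟦∈∖⟧≤ e u v)) (≤-reflexive (*-comm ⟦ v ∈? e ⟧ _))))

    accept : ∀ {A T G τ v} → State A T G (suc τ) → w ≤ deg (usable A G) v →
      State (A ∖ v) (v ∷ T) (take w (links A G v) ++ G) τ
    accept {A} {T} {G} {τ} {v} st w≤ = record
      { uniq   = UniqueP.filter⁺ _ (uniq st)
      ; sub    = sub st ∘ ∖-⊆ A
      ; T₀⊆T   = there ∘ T₀⊆T st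
      ; hyp    = record { short = short' ; inside = inside' ; bad = bad' }
      ; deg≤   = deg≤'
      ; codeg≤ = codeg≤'
      ; size   = size'
      }
      where
      open ≤-Reasoning
      -- Keeping exactly `w` links makes `size` an equality, so `G` never has more than `w * t`
      -- edges.
      new = take w (links A G v)
      bad-∷ : ∀ {e} → ¬ P (e ++ T) → ¬ P (e ++ v ∷ T)
      bad-∷ {e} ¬p p = ¬p (antitone sub' p)
        where
        sub' : e ++ T ⊆ e ++ v ∷ T
        sub' i with ∈-++⁻ e i
        ... | inj₁ j = ∈-++⁺ˡ j
        ... | inj₂ j = ∈-++⁺ʳ e (there j)
      bad-∖ : ∀ {e} → ¬ P (e ++ T₀) → ¬ P ((e ∖ v) ++ v ∷ T)
      bad-∖ {e} ¬p p = ¬p (antitone sub' p)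
        where
        sub' : e ++ T₀ ⊆ (e ∖ v) ++ v ∷ T
        sub' {x} i with ∈-++⁻ e i
        ... | inj₂ j = ∈-++⁺ʳ (e ∖ v) (there (T₀⊆T st j))
        ... | inj₁ j with x ≟ v
        ...   | yes refl = ∈-++⁺ʳ (e ∖ v) (here refl)
        ...   | no x≢v   = ∈-++⁺ˡ (∈-∖ j x≢v)
      short' : ∀ {e} → e ∈ new ++ G → length e ≤ r
      short' e∈ with ∈-++⁻ new e∈
      ... | inj₂ i = short (hyp st) i
      ... | inj₁ i with ∈-links A G v (∈-take w i)
      ...   | e , e∈H₀ , _ , v∈e , refl = s≤s⁻¹ (≤-trans (length-∖ v∈e) (short hyp₀ e∈H₀))
      inside' : ∀ {e} → e ∈ new ++ G → e ⊆ A₀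
      inside' e∈ with ∈-++⁻ new e∈
      ... | inj₂ i = inside (hyp st) i
      ... | inj₁ i with ∈-links A G v (∈-take w i)
      ...   | e , e∈H₀ , _ , v∈e , refl = inside hyp₀ e∈H₀ ∘ ∖-⊆ e
      bad' : ∀ {e} → e ∈ new ++ G → ¬ P (e ++ v ∷ T)
      bad' {e} e∈ with ∈-++⁻ new e∈
      ... | inj₂ i = bad-∷ {e} (bad (hyp st) i)
      ... | inj₁ i with ∈-links A G v (∈-take w i)
      ...   | e₀ , e∈H₀ , _ , v∈e , refl = bad-∖ {e₀} (bad hyp₀ e∈H₀)
      deg≤' : ∀ u → deg (new ++ G) u ≤ cap + K
      deg≤' u = ≤-trans (≤-reflexive (∑-++ new G _)) (bound (u ≟ v) (deg G u <? cap))
        where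
        -- Three cases: `v` lies in no link of itself, a saturated vertex lies in no usable edge,
        -- and any other vertex starts below `cap` and gains at most a codegree.
        zero-new : (∀ {e} → e ∈ new → u ∉ e) → deg new u + deg G u ≤ cap + K
        zero-new avoid = +-mono-≤ (avoid⇒deg≡0 new u avoid) (deg≤ st u)
        bound : Dec (u ≡ v) → Dec (deg G u < cap) → deg new u + deg G u ≤ cap + K
        bound (yes refl) _ = zero-new avoid
          where
          avoid : ∀ {e'} → e' ∈ new → u ∉ e'
          avoid i u∈ with ∈-links A G v (∈-take w i)
          ... | e , _ , _ , _ , refl = ∉-∖ e v u∈
        bound (no _) (no sat) = zero-new avoid
          where
          avoid : ∀ {e'} → e' ∈ new → u ∉ e'
          avoid i u∈ with ∈-links A G v (∈-take w i)
          ... | e , _ , free , _ , refl = sat (proj₂ (All.lookup free (∖-⊆ e u∈)))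
        bound (no u≢v) (yes d<cap) = ≤-trans
          (+-mono-≤ (≤-trans (∑-take w (links A G v) _)
                       (≤-trans (deg-links-codeg A G u v) (≤-trans (m≤n+m _ _) (codeg≤ st u≢v))))
                    (<⇒≤ d<cap))
          (≤-reflexive (+-comm K cap))
      codeg≤' : ∀ {u u'} → u ≢ u' → codeg (new ++ G) u u' + codeg (alive (A ∖ v)) u u' ≤ K
      codeg≤' {u} {u'} u≢u' = begin
        codeg (new ++ G) u u' + codeg (alive (A ∖ v)) u u'
          ≡⟨ cong (_+ _) (∑-++ new G _) ⟩
        codeg new u u' + codeg G u u' + codeg (alive (A ∖ v)) u u'
          ≤⟨ +-monoˡ-≤ _ (+-monoˡ-≤ (codeg G u u') (∑-take w (links A G v) _)) ⟩
        codeg (links A G v) u u' + codeg G u u' + codeg (alive (A ∖ v)) u u'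
          ≡⟨ rearrange (codeg (links A G v) u u') _ _ ⟩
        codeg G u u' + (codeg (links A G v) u u' + codeg (alive (A ∖ v)) u u')
          ≤⟨ +-monoʳ-≤ (codeg G u u') (codeg-links A G v) ⟩
        codeg G u u' + codeg (alive A) u u'
          ≤⟨ codeg≤ st u≢u' ⟩
        K ∎
        where
        rearrange : ∀ a b c → a + b + c ≡ b + (a + c)
        rearrange = solve-∀
      length-links : length (links A G v) ≡ deg (usable A G) v
      length-links = trans (length-map (_∖ v) (filter (v ∈?_) (usable A G)))
        (length-filter≡∑ (v ∈?_) (usable A G))
      size' : length (new ++ G) + w * τ ≡ w * t
      size' = trans (cong (_+ w * τ) (trans (length-++ new) (cong (_+ length G)
          (trans (length-take w (links A G v)) (m≤n⇒m⊓n≡m (≤-trans w≤ (≤-reflexive (sym length-links))))))))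
        (trans (rearrange w (length G) τ) (size st))
        where
        rearrange : ∀ w g τ → w + g + w * τ ≡ g + w * suc τ
        rearrange = solve-∀

    -- Each query deletes a vertex and at most `τ` more queries are accepted, so the tree of answers
    -- has at most `suc a ^ τ` leaves, each worth at most `Z`.
    loop : ∀ a {A T G} τ → length A ≤ a → State A T G τ → cnt A T ≤ suc a ^ τ * Z
    loop a {A} {G = G} zero A≤a st = ≤-trans
      (next (uniq st) (sub st) (hyp st) (deg≤ st) (λ u≢v → ≤-trans (m≤m+n _ _) (codeg≤ st u≢v))
        (≤-reflexive (trans (sym (size st)) (trans (cong (length G +_) (*-zeroʳ w)) (+-identityʳ _)))))
      (≤-reflexive (sym (*-identityˡ Z)))
    loop a {A} {T} (suc τ) A≤a st with length A + s ≤? length A₀ | P? T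
    ... | yes small | _ = ≤-trans (finish (uniq st) (sub st) small) (≤-trans Y≤Z
            (m≤n*m Z (suc a ^ suc τ) {{>-nonZero (m^n>0 (suc a) (suc τ))}}))
    ... | no _ | no ¬p = ¬P⇒cnt≤ A ¬p
    ... | no big | yes p with pivot st (≰⇒> big) p
    loop zero {[]} (suc τ) A≤a st | no _ | yes _ | v , () , _
    loop (suc a) {A} {T} (suc τ) A≤a st | no _ | yes _ | v , v∈A , w≤ = begin
      cnt A T
        ≤⟨ cnt-query T (uniq st) v∈A ⟩
      cnt (A ∖ v) T + cnt (A ∖ v) (v ∷ T)
        ≤⟨ +-mono-≤ (loop a (suc τ) smaller (decline st)) (loop a τ smaller (accept st w≤)) ⟩
      suc a ^ suc τ * Z + suc a ^ τ * Z
        ≡⟨ sym (*-distribʳ-+ Z (suc a ^ suc τ) _) ⟩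
      (suc a ^ suc τ + suc a ^ τ) * Z
        ≡⟨ cong (_* Z) (+-comm (suc a ^ suc τ) _) ⟩
      suc (suc a) * suc a ^ τ * Z
        ≤⟨ *-monoˡ-≤ Z (*-monoʳ-≤ (suc (suc a)) (^-monoˡ-≤ τ (n≤1+n (suc a)))) ⟩
      suc (suc a) ^ suc τ * Z ∎
      where
      open ≤-Reasoning
      smaller : length (A ∖ v) ≤ a
      smaller = s≤s⁻¹ (≤-trans (length-∖ v∈A) A≤a)

    phase : ∀ {A} → Unique A → A ⊆ A₀ → (∀ {u v} → u ≢ v → codeg H₀ u v ≤ K) →
            cnt A T₀ ≤ suc n ^ t * Z
    phase {A} uniq' sub' codeg₀ = ≤-trans (loop (length A) t ≤-refl start) (*-monoˡ-≤ Z (^-monoˡ-≤ t (s≤s A≤n)))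
      where
      A≤n : length A ≤ n
      A≤n = ≤-trans (≤-trans (m≤m+n _ _) (length+∑-∉≤ uniq' sub')) A₀≤n
      start : State A T₀ [] t
      start = record
        { uniq   = uniq'
        ; sub    = sub'
        ; T₀⊆T   = id
        ; hyp    = record { short = λ () ; inside = λ () ; bad = λ () }
        ; deg≤   = λ _ → z≤n
        ; codeg≤ = λ {u} {v} u≢v → ≤-trans (≤-reflexive (∑-filter (All.all? (_∈? A)) H₀ _)) (≤-trans
            (∑-mono H₀ λ {e} _ → ≤-trans (*-monoˡ-≤ (⟦ u ∈? e ⟧ * ⟦ v ∈? e ⟧) (⟦⟧≤1 (All.all? (_∈? A) e)))
                                          (≤-reflexive (*-identityˡ _)))
            (codeg₀ u≢v))
        ; size   = refl
        }

-- Powers of two, and the iteration of rounds and runs.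

2^-+ : ∀ a b → 2 ^ a * 2 ^ b ≡ 2 ^ (a + b)
2^-+ a b = sym (^-distribˡ-+-* 2 a b)

2^-double : ∀ a → 2 ^ a + 2 ^ a ≡ 2 ^ suc a
2^-double a = cong (2 ^ a +_) (sym (+-identityʳ _))

2^-mono : ∀ {a b} → a ≤ b → 2 ^ a ≤ 2 ^ b
2^-mono = ^-monoʳ-≤ 2

2^>0 : ∀ a → 0 < 2 ^ a
2^>0 = m^n>0 2

2^-cancel-< : ∀ {a b} → 2 ^ a < 2 ^ b → a < b
2^-cancel-< {a} {b} lt = ≰⇒> λ b≤a → <⇒≱ lt (2^-mono b≤a)

2^-cancel-≤ : ∀ {a b} → 2 ^ a ≤ 2 ^ b → a ≤ b
2^-cancel-≤ {a} {b} le = ≮⇒≥ λ b<a → <⇒≱ (^-monoʳ-< 2 ≤-refl b<a) le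

module Rounds {V : Set} (_≟_ : DecidableEquality V)
  (P : List V → Set) (P? : Decidable P)
  (antitone : ∀ {S S'} → S ⊆ S' → P S' → P S) where

  open Containers _≟_ P P? antitone
  open Hypergraph

  -- In the round that reduces the edge size from r to r − 1, Phase is used with w = 2^(ω₀ + r(θ+1)),
  -- t = 2^τ, S = 2^(ν−p−2) and cap = 2^(κ + ω₀ + (r−1)(θ+1) + p + 3).  Here 2^(−p) bounds from below the
  -- ratio of average to maximum degree, up to a constant, and p grows by κ + 3.
  rounds : ∀ {A₀} → Unique A₀ → ∀ {K R Y κ ν σ τ θ ω₀} →
    length A₀ ≤ 2 ^ ν → ν ≡ τ + θ → K ≤ 2 ^ ω₀ → R ≤ 2 ^ κ →
    (∀ {A T} → Unique A → A ⊆ A₀ → length A + 2 ^ σ ≤ length A₀ → cnt A T ≤ Y) →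
    ∀ r {p A T H} → r ≤ R → ν ≡ σ + r * (κ + 3) + p + 2 →
    Unique A → A ⊆ A₀ → Hypergraph A₀ T r H →
    (∀ v → deg H v ≤ 2 ^ (ω₀ + r * (θ + 1) + p + 1)) →
    (∀ {u v} → u ≢ v → codeg H u v ≤ K) →
    2 ^ (ω₀ + r * (θ + 1) + 1 + ν) ≤ length H →
    cnt A T ≤ (suc (2 ^ ν) ^ (2 ^ τ)) ^ r * Y
  rounds uniq₀ {ν = ν} {ω₀ = ω₀} A₀≤ ν≡ K≤ R≤ finish zero {A = A} {T} {[]} _ _ uniq sub hyp deg≤ codeg≤ large
    = contradiction large (<⇒≱ (2^>0 (ω₀ + 0 + 1 + ν)))
  -- An edge of size zero is empty, so its badness says that `T` alone violates `P` and nothing is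
  -- counted.
  rounds uniq₀ A₀≤ ν≡ K≤ R≤ finish zero {A = A} {T} {[] ∷ H} _ _ uniq sub hyp deg≤ codeg≤ large
    = ¬P⇒cnt≤ A (bad hyp (here refl))
  rounds uniq₀ A₀≤ ν≡ K≤ R≤ finish zero {A = A} {T} {(x ∷ e) ∷ H} _ _ uniq sub hyp deg≤ codeg≤ large
    = contradiction (short hyp (here refl)) λ ()
  rounds {A₀} uniq₀ {K} {R} {Y} {κ} {ν} {σ} {τ} {θ} {ω₀} A₀≤ ν≡ K≤ R≤ finish (suc r) {p} {A} {T} {H} r<R ν≡' uniq sub hyp deg≤ codeg≤ large
    = ≤-trans (phase uniq sub codeg≤) (≤-reflexive (sym (*-assoc base (base ^ r) Y)))
    where
    open ≤-Reasoning
    base = suc (2 ^ ν) ^ (2 ^ τ)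
    ω' = ω₀ + r * (θ + 1)
    ω  = ω₀ + suc r * (θ + 1)
    ς  = σ + suc r * (κ + 3)
    cap = κ + ω' + p + 3
    K≤cap : K ≤ 2 ^ cap
    K≤cap = ≤-trans K≤ (2^-mono (≤-trans (m≤m+n ω₀ (r * (θ + 1) + κ + p + 3)) (≤-reflexive (eq ω₀ (r * (θ + 1)) κ p))))
      where
      eq : ∀ a b k p → a + (b + k + p + 3) ≡ k + (a + b) + p + 3
      eq = solve-∀
    many : 2 ^ (ω + p + 1) * 2 ^ σ + 2 ^ (ω + p + 1) * 2 ^ ς + 2 ^ ν * 2 ^ ω ≤ length H
    many = begin
      2 ^ (ω + p + 1) * 2 ^ σ + 2 ^ (ω + p + 1) * 2 ^ ς + 2 ^ ν * 2 ^ ω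
        ≤⟨ +-monoˡ-≤ _ (+-monoˡ-≤ _ (*-monoʳ-≤ (2 ^ (ω + p + 1)) (2^-mono (m≤m+n σ _)))) ⟩
      2 ^ (ω + p + 1) * 2 ^ ς + 2 ^ (ω + p + 1) * 2 ^ ς + 2 ^ ν * 2 ^ ω
        ≡⟨ cong₂ (λ a b → a + a + b) (2^-+ (ω + p + 1) ς) (2^-+ ν ω) ⟩
      2 ^ (ω + p + 1 + ς) + 2 ^ (ω + p + 1 + ς) + 2 ^ (ν + ω)
        ≡⟨ cong₂ _+_ (2^-double (ω + p + 1 + ς)) (cong (2 ^_) (trans (cong (_+ ω) ν≡') (eq₁ ς p ω))) ⟩
      2 ^ suc (ω + p + 1 + ς) + 2 ^ suc (ω + p + 1 + ς)
        ≡⟨ 2^-double (suc (ω + p + 1 + ς)) ⟩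
      2 ^ suc (suc (ω + p + 1 + ς))
        ≡⟨ cong (2 ^_) (trans (eq₂ ς p ω) (cong (ω + 1 +_) (sym ν≡'))) ⟩
      2 ^ (ω + 1 + ν)
        ≤⟨ large ⟩
      length H ∎
      where
      eq₁ : ∀ ς p ω → ς + p + 2 + ω ≡ suc (ω + p + 1 + ς)
      eq₁ = solve-∀
      eq₂ : ∀ ς p ω → suc (suc (ω + p + 1 + ς)) ≡ ω + 1 + (ς + p + 2)
      eq₂ = solve-∀
    cap≥ : 2 ^ ω * 2 ^ τ * r ≤ 2 ^ ς * 2 ^ cap
    cap≥ = begin
      2 ^ ω * 2 ^ τ * r       ≤⟨ *-monoʳ-≤ (2 ^ ω * 2 ^ τ) (≤-trans (<⇒≤ r<R) R≤) ⟩
      2 ^ ω * 2 ^ τ * 2 ^ κ   ≡⟨ trans (cong (_* 2 ^ κ) (2^-+ ω τ)) (2^-+ (ω + τ) κ) ⟩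
      2 ^ (ω + τ + κ)         ≡⟨ cong (2 ^_) (trans (eq₁ ω₀ r θ τ κ) (trans (cong (λ ν → ω' + 1 + ν + κ) (trans (sym ν≡) ν≡')) (eq₂ ω' ς p κ))) ⟩
      2 ^ (ς + cap)           ≡⟨ sym (2^-+ ς cap) ⟩
      2 ^ ς * 2 ^ cap         ∎
      where
      eq₁ : ∀ ω₀ r θ τ κ → ω₀ + suc r * (θ + 1) + τ + κ ≡ ω₀ + r * (θ + 1) + 1 + (τ + θ) + κ
      eq₁ = solve-∀
      eq₂ : ∀ ω' ς p κ → ω' + 1 + (ς + p + 2) + κ ≡ ς + (κ + ω' + p + 3)
      eq₂ = solve-∀
    next : ∀ {A T G} → Unique A → A ⊆ A₀ → Hypergraph A₀ T r G →
           (∀ v → deg G v ≤ 2 ^ cap + K) → (∀ {u v} → u ≢ v → codeg G u v ≤ K) →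
           2 ^ ω * 2 ^ τ ≤ length G → cnt A T ≤ base ^ r * Y
    next {G = G} uniq sub hyp deg≤ codeg≤ size =
      rounds uniq₀ {K} {R} {Y} {κ} {ν} {σ} {τ} {θ} {ω₀} A₀≤ ν≡ K≤ R≤ finish r {p + κ + 3} (<⇒≤ r<R) (trans ν≡' (eq₁ σ r κ p)) uniq sub hyp
        (λ v → ≤-trans (deg≤ v) (≤-trans (+-monoʳ-≤ (2 ^ cap) K≤cap)
          (≤-reflexive (trans (2^-double cap) (cong (2 ^_) (eq₂ κ ω' p))))))
        codeg≤
        (≤-trans (≤-reflexive (trans (cong (2 ^_) (trans (cong (ω' + 1 +_) ν≡) (eq₃ ω₀ r θ τ))) (sym (2^-+ ω τ)))) size)
      where
      eq₁ : ∀ σ r κ p → σ + suc r * (κ + 3) + p + 2 ≡ σ + r * (κ + 3) + (p + κ + 3) + 2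
      eq₁ = solve-∀
      eq₂ : ∀ κ ω' p → suc (κ + ω' + p + 3) ≡ ω' + (p + κ + 3) + 1
      eq₂ = solve-∀
      eq₃ : ∀ ω₀ r θ τ → ω₀ + r * (θ + 1) + 1 + (τ + θ) ≡ ω₀ + suc r * (θ + 1) + τ
      eq₃ = solve-∀
    open Phase {A₀} {T} uniq₀ {r} {2 ^ (ω + p + 1)} {K} {2 ^ ω} {2 ^ τ} {2 ^ cap} {2 ^ ς} {2 ^ σ} {2 ^ ν}
      {Y} {base ^ r * Y} {H} hyp deg≤ (2^>0 ν) (2^>0 ω) (2^>0 cap) A₀≤ many cap≥
      (m≤n*m Y (base ^ r) {{m^n≢0 base r {{m^n≢0 (suc (2 ^ ν)) (2 ^ τ)}}}})
      finish next

  -- As long as `A` has more than `X` points it carries a new hypergraph, and one run of all rounds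
  -- discards at least 2^σ points at the price of a factor `base`. `j` bounds the number of runs
  -- still to come.
  iterated-containers : ∀ {P₀ K R κ ν σ τ θ ω₀ p X} →
    length P₀ ≤ 2 ^ ν → ν ≡ τ + θ → K ≤ 2 ^ ω₀ → R ≤ 2 ^ κ → ν ≡ σ + R * (κ + 3) + p + 2 →
    Unique P₀ →
    (∀ {A} → Unique A → A ⊆ P₀ → X < length A → ∃[ H ]
      Hypergraph A [] R H ×
      (∀ v → deg H v ≤ 2 ^ (ω₀ + R * (θ + 1) + p + 1)) ×
      (∀ {u v} → u ≢ v → codeg H u v ≤ K) ×
      2 ^ (ω₀ + R * (θ + 1) + 1 + ν) ≤ length H) →
    ∀ j {A T} → Unique A → A ⊆ P₀ → length A ≤ X + j * 2 ^ σ →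
    cnt A T ≤ ((suc (2 ^ ν) ^ (2 ^ τ)) ^ R) ^ j * 2 ^ X
  iterated-containers {P₀} {K} {R} {κ} {ν} {σ} {τ} {θ} {ω₀} {p} {X} P₀≤ ν≡ K≤ R≤ ν≡' uniq₀ hyper = go
    where
    open ≤-Reasoning
    base = (suc (2 ^ ν) ^ (2 ^ τ)) ^ R
    base≢0 : NonZero base
    base≢0 = m^n≢0 (suc (2 ^ ν) ^ (2 ^ τ)) R {{m^n≢0 (suc (2 ^ ν)) (2 ^ τ)}}
    small : ∀ j A T → length A ≤ X → cnt A T ≤ base ^ j * 2 ^ X
    small j A T A≤X = begin
      cnt A T           ≤⟨ cnt≤2^ A T ⟩
      2 ^ length A      ≤⟨ 2^-mono A≤X ⟩
      2 ^ X             ≤⟨ m≤n*m (2 ^ X) (base ^ j) {{m^n≢0 base j {{base≢0}}}} ⟩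
      base ^ j * 2 ^ X  ∎
    go : ∀ j {A T} → Unique A → A ⊆ P₀ → length A ≤ X + j * 2 ^ σ → cnt A T ≤ base ^ j * 2 ^ X
    go zero {A} {T} uniq sub A≤ = small 0 A T (≤-trans A≤ (≤-reflexive (+-identityʳ X)))
    go (suc j) {A} {T} uniq sub A≤ with length A ≤? X
    ... | yes A≤X = small (suc j) A T A≤X
    ... | no A≰X with hyper uniq sub (≰⇒> A≰X)
    ...   | H , hyp , deg≤ , codeg≤ , large = begin
      -- The selections of earlier runs are forgotten: the new hypergraph is bad over the empty
      -- list.
      cnt A T                     ≤⟨ cnt-antitone A (λ ()) ⟩
      cnt A []                    ≤⟨ rounds uniq {K} {R} {base ^ j * 2 ^ X} {κ} {ν} {σ} {τ} {θ} {ω₀}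
                                       (≤-trans (≤-trans (m≤m+n _ _) (length+∑-∉≤ uniq sub)) P₀≤)
                                       ν≡ K≤ R≤ finish R {p} {A} {[]} {H} ≤-refl ν≡' uniq id hyp deg≤ codeg≤ large ⟩
      base * (base ^ j * 2 ^ X)   ≡⟨ sym (*-assoc base (base ^ j) (2 ^ X)) ⟩
      base ^ suc j * 2 ^ X        ∎
      where
      finish : ∀ {A' T} → Unique A' → A' ⊆ A → length A' + 2 ^ σ ≤ length A → cnt A' T ≤ base ^ j * 2 ^ X
      finish {A'} uniq' sub' le = go j uniq' (sub ∘ sub') (+-cancelʳ-≤ (2 ^ σ) _ _ (begin
        length A' + 2 ^ σ       ≤⟨ le ⟩
        length A                ≤⟨ A≤ ⟩
        X + suc j * 2 ^ σ       ≡⟨ eq X j (2 ^ σ) ⟩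
        X + j * 2 ^ σ + 2 ^ σ   ∎))
        where
        eq : ∀ X j s → X + suc j * s ≡ X + j * s + s
        eq = solve-∀

-- Many moduli of which few divide any given number.

lcmUpTo : ℕ → ℕ
lcmUpTo zero    = 1
lcmUpTo (suc n) = lcm (lcmUpTo n) (suc n)

lcmUpTo>0 : ∀ n → 0 < lcmUpTo n
lcmUpTo>0 zero    = s≤s z≤n
lcmUpTo>0 (suc n) = n≢0⇒n>0 λ eq → n>0⇒n≢0 (*-mono-≤ (s≤s (z≤n {n})) (lcmUpTo>0 n))
  (0∣⇒≡0 (subst (_∣ suc n * lcmUpTo n) eq (lcm-least (n∣m*n (suc n)) (m∣m*n (lcmUpTo n)))))

∣lcmUpTo : ∀ {m} n → 0 < m → m ≤ n → m ∣ lcmUpTo n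
∣lcmUpTo zero    0<m m≤0 = contradiction m≤0 (<⇒≱ 0<m)
∣lcmUpTo (suc n) 0<m m≤  with m≤n⇒m<n∨m≡n m≤
... | inj₂ refl = n∣lcm[m,n] (lcmUpTo n) (suc n)
... | inj₁ m<   = ∣-trans (∣lcmUpTo n 0<m (s≤s⁻¹ m<)) (m∣lcm[m,n] (lcmUpTo n) (suc n))

-- The Beta integrals B(a+1, b+1) = a! b! / (a+b+1)! satisfy
-- B(a+1, b+1) = B(a+2, b+1) + B(a+1, b+2), so ℓ · B(a+1, b+1) is an integer.
beta-∣ : ∀ {ℓ} a b → (∀ {m} → 0 < m → m ≤ suc (a + b) → m ∣ ℓ) → suc (a + b) ! ∣ a ! * b ! * ℓ
beta-∣ {ℓ} a zero all∣ rewrite +-identityʳ a = subst₂ _∣_ (*-comm (a !) (suc a)) (cong (_* ℓ) (sym (*-identityʳ (a !))))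
  (*-monoʳ-∣ (a !) (all∣ (s≤s z≤n) ≤-refl))
beta-∣ {ℓ} a (suc b) all∣ rewrite +-suc a b =
  ∣m+n∣m⇒∣n {m = suc a ! * b ! * ℓ} (subst (suc (suc (a + b)) ! ∣_) (eq a b (a !) (b !) ℓ)
      (*-monoʳ-∣ (suc (suc (a + b))) (beta-∣ a b (λ 0<m m≤ → all∣ 0<m (m≤n⇒m≤1+n m≤)))))
    (beta-∣ (suc a) b all∣)
  where
  eq : ∀ a b x y ℓ → suc (suc (a + b)) * (x * y * ℓ) ≡ suc a * x * y * ℓ + x * (suc b * y) * ℓ
  eq = solve-∀

-- From m to m + 1 the quotient (2m+1)! / (m!)² grows by the factor (2m+2)(2m+3)/(m+1)², which
-- exceeds 4.
4^*!²≤ : ∀ m → 4 ^ m * (m ! * m !) ≤ suc (m + m) !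
4^*!²≤ zero    = ≤-refl
4^*!²≤ (suc m) = begin
  4 * 4 ^ m * (suc m * m ! * (suc m * m !))              ≡⟨ eq₁ m (4 ^ m) (m !) ⟩
  4 * (suc m * suc m) * (4 ^ m * (m ! * m !))            ≤⟨ *-monoʳ-≤ (4 * (suc m * suc m)) (4^*!²≤ m) ⟩
  4 * (suc m * suc m) * suc (m + m) !                    ≤⟨ *-monoˡ-≤ (suc (m + m) !) (≤-trans (m≤m+n (4 * (suc m * suc m)) (m + m + 2)) (≤-reflexive (eq₂ m))) ⟩
  suc (suc (suc (m + m))) * suc (suc (m + m)) * suc (m + m) !  ≡⟨ *-assoc (suc (suc (suc (m + m)))) (suc (suc (m + m))) (suc (m + m) !) ⟩
  suc (suc (suc (m + m))) !                              ≡⟨ cong (λ z → suc (suc z) !) (sym (+-suc m m)) ⟩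
  suc (suc m + suc m) !                                  ∎
  where
  open ≤-Reasoning
  eq₁ : ∀ m p x → 4 * p * (suc m * x * (suc m * x)) ≡ 4 * (suc m * suc m) * (p * (x * x))
  eq₁ = solve-∀
  eq₂ : ∀ m → 4 * (suc m * suc m) + (m + m + 2) ≡ suc (suc (suc (m + m))) * suc (suc (m + m))
  eq₂ = solve-∀

-- Nair's argument: ℓ B(m+1, m+1) is a positive integer, hence ℓ is at least (2m+1)! / (m!)².
4^≤lcmUpTo : ∀ m → 4 ^ m ≤ lcmUpTo (suc (m + m))
4^≤lcmUpTo m = *-cancelʳ-≤ (4 ^ m) _ (m ! * m !) {{m!²≢0}} (begin
  4 ^ m * (m ! * m !)    ≤⟨ 4^*!²≤ m ⟩
  suc (m + m) !          ≤⟨ ∣⇒≤ {{m*n≢0 (m ! * m !) ℓ {{m!²≢0}} {{>-nonZero (lcmUpTo>0 (suc (m + m)))}}}}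
                              (beta-∣ m m (∣lcmUpTo (suc (m + m)))) ⟩
  m ! * m ! * ℓ          ≡⟨ *-comm (m ! * m !) ℓ ⟩
  ℓ * (m ! * m !)        ∎)
  where
  open ≤-Reasoning
  ℓ = lcmUpTo (suc (m + m))
  m!²≢0 : NonZero (m ! * m !)
  m!²≢0 = m*n≢0 (m !) (m !) {{m !≢0}} {{m !≢0}}

-- These are the prime powers up to n, but only this characterisation matters.
moduli : ℕ → List ℕ
moduli zero    = []
moduli (suc n) with suc n ∣? lcmUpTo n
... | yes _ = moduli n
... | no  _ = suc n ∷ moduli n

∈-moduli : ∀ {q} n → q ∈ moduli n → 0 < q × q ≤ n
∈-moduli (suc n) q∈ with suc n ∣? lcmUpTo n
∈-moduli (suc n) (here refl) | no _  = s≤s z≤n , ≤-refl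
∈-moduli (suc n) (there q∈)  | no _  = let 0<q , q≤ = ∈-moduli n q∈ in 0<q , m≤n⇒m≤1+n q≤
∈-moduli (suc n) q∈          | yes _ = let 0<q , q≤ = ∈-moduli n q∈ in 0<q , m≤n⇒m≤1+n q≤

-- The lcm grows only at the moduli, by a factor of at most `b` each time; a large lcm therefore
-- forces many moduli.
lcmUpTo≤^ : ∀ {b} n → n ≤ b → lcmUpTo n ≤ b ^ length (moduli n)
lcmUpTo≤^ zero _ = ≤-refl
lcmUpTo≤^ {b} (suc n) n<b with suc n ∣? lcmUpTo n
... | yes n∣ = ≤-trans (∣⇒≤ {{>-nonZero (lcmUpTo>0 n)}} (lcm-least ∣-refl n∣)) (lcmUpTo≤^ n (<⇒≤ n<b))
... | no  _  = ≤-trans (∣⇒≤ {{m*n≢0 (suc n) (lcmUpTo n) {{_}} {{>-nonZero (lcmUpTo>0 n)}}}}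
    (lcm-least (n∣m*n (suc n)) (m∣m*n (lcmUpTo n))))
  (*-mono-≤ n<b (lcmUpTo≤^ n (<⇒≤ n<b)))

gcd≢0 : ∀ {d} n → 0 < d → gcd d (lcmUpTo n) ≢ 0
gcd≢0 n 0<d eq = n>0⇒n≢0 0<d (gcd[m,n]≡0⇒m≡0 eq)

gcd-monoʳ-∣ : ∀ d n → gcd d (lcmUpTo n) ∣ gcd d (lcmUpTo (suc n))
gcd-monoʳ-∣ d n = gcd-greatest (gcd[m,n]∣m d (lcmUpTo n))
  (∣-trans (gcd[m,n]∣n d (lcmUpTo n)) (m∣lcm[m,n] (lcmUpTo n) (suc n)))

gcd≤ : ∀ {d} n → 0 < d → gcd d (lcmUpTo n) ≤ gcd d (lcmUpTo (suc n))
gcd≤ {d} n 0<d = ∣⇒≤ {{≢-nonZero (gcd≢0 (suc n) 0<d)}} (gcd-monoʳ-∣ d n)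

-- A modulus does not divide the lcm of the smaller numbers. If it divides `d`, the gcd of `d` with
-- the lcm must grow there, and being replaced by a proper multiple it at least doubles.
2^∑∣≤gcd : ∀ {d} n → 0 < d → 2 ^ ∑ (moduli n) (λ q → ⟦ q ∣? d ⟧) ≤ gcd d (lcmUpTo n)
2^∑∣≤gcd {d} zero 0<d = n≢0⇒n>0 λ eq → n>0⇒n≢0 0<d (gcd[m,n]≡0⇒m≡0 eq)
2^∑∣≤gcd {d} (suc n) 0<d with suc n ∣? lcmUpTo n
... | yes _ = ≤-trans (2^∑∣≤gcd n 0<d) (gcd≤ n 0<d)
... | no n∤ with suc n ∣? d
...   | no _ = ≤-trans (2^∑∣≤gcd n 0<d) (gcd≤ n 0<d)
...   | yes n∣d = ≤-trans (*-monoʳ-≤ 2 (2^∑∣≤gcd n 0<d)) (double (gcd-monoʳ-∣ d n))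
  where
  new = gcd d (lcmUpTo (suc n))
  double : gcd d (lcmUpTo n) ∣ new → 2 * gcd d (lcmUpTo n) ≤ new
  double (divides zero eq)          = contradiction eq (gcd≢0 (suc n) 0<d)
  double (divides (suc zero) eq)    = contradiction
    (∣-trans (subst (suc n ∣_) (trans eq (*-identityˡ _)) (gcd-greatest n∣d (n∣lcm[m,n] (lcmUpTo n) (suc n))))
             (gcd[m,n]∣n d (lcmUpTo n))) n∤
  double (divides (suc (suc c)) eq) = ≤-trans (*-monoˡ-≤ (gcd d (lcmUpTo n)) (s≤s (s≤s (z≤n {c})))) (≤-reflexive (sym eq))

∑∣≤ : ∀ {d} n l → 0 < d → d < 2 ^ l → ∑ (moduli n) (λ q → ⟦ q ∣? d ⟧) ≤ l
∑∣≤ {d} n l 0<d d< = <⇒≤ (2^-cancel-< (≤-<-trans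
  (≤-trans (2^∑∣≤gcd n 0<d) (∣⇒≤ {{>-nonZero 0<d}} (gcd[m,n]∣m d (lcmUpTo n)))) d<))

≤*length-moduli : ∀ {a e} n → 2 ^ a ≤ lcmUpTo n → n ≤ 2 ^ e → a ≤ e * length (moduli n)
≤*length-moduli {a} {e} n a≤ n≤ = 2^-cancel-≤ (begin
  2 ^ a                           ≤⟨ a≤ ⟩
  lcmUpTo n                       ≤⟨ lcmUpTo≤^ n n≤ ⟩
  (2 ^ e) ^ length (moduli n)     ≡⟨ ^-*-assoc 2 e (length (moduli n)) ⟩
  2 ^ (e * length (moduli n))     ∎)
  where open ≤-Reasoning

many-moduli : ∀ g → 2 ^ suc g ≤ suc (suc g) * length (moduli (suc (2 ^ g + 2 ^ g)))
many-moduli g = ≤*length-moduli {e = suc (suc g)} (suc (2 ^ g + 2 ^ g))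
  (≤-trans (≤-reflexive (sym (^-*-assoc 2 2 (2 ^ g)))) (4^≤lcmUpTo (2 ^ g)))
  (≤-trans (+-monoˡ-≤ (2 ^ g + 2 ^ g) (2^>0 (suc g)))
    (≤-reflexive (trans (cong (2 ^ suc g +_) (2^-double g)) (2^-double (suc g)))))

n<2^n : ∀ n → n < 2 ^ n
n<2^n zero    = s≤s z≤n
n<2^n (suc n) = ≤-trans (+-mono-≤ (2^>0 n) (n<2^n n)) (≤-reflexive (2^-double n))

-- Up to 2^(2x+3) + 1 there are at least 2^(2x+3) / (2x+4) moduli, more than the 2^x that are kept.
-- The generosity is harmless, as only a polynomial relation between number and size of the moduli
-- matters.
sparse-moduli : ∀ x → ∃[ qs ] length qs ≡ 2 ^ x ×
  (∀ {q} → q ∈ qs → 0 < q × q ≤ 2 ^ (x + x + 4)) ×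
  (∀ {d l} → 0 < d → d < 2 ^ l → ∑ qs (λ q → ⟦ q ∣? d ⟧) ≤ l)
sparse-moduli x = take (2 ^ x) (moduli n)
  , trans (length-take (2 ^ x) (moduli n)) (m≤n⇒m⊓n≡m enough)
  , (λ q∈ → let 0<q , q≤ = ∈-moduli n (∈-take (2 ^ x) q∈) in 0<q , ≤-trans q≤ n≤)
  , (λ {d} {l} 0<d d< → ≤-trans (∑-take (2 ^ x) (moduli n) _) (∑∣≤ n l 0<d d<))
  where
  open ≤-Reasoning
  g = x + x + 2
  n = suc (2 ^ g + 2 ^ g)
  n≤ : n ≤ 2 ^ (x + x + 4)
  n≤ = ≤-trans (+-monoˡ-≤ (2 ^ g + 2 ^ g) (2^>0 (suc g))) (≤-reflexive
    (trans (cong (2 ^ suc g +_) (2^-double g)) (trans (2^-double (suc g)) (cong (2 ^_) (eq x)))))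
    where
    eq : ∀ x → suc (suc (x + x + 2)) ≡ x + x + 4
    eq = solve-∀
  linear : suc (suc g) ≤ 2 ^ (x + 3)
  linear = begin
    suc (suc g)            ≤⟨ ≤-trans (m≤m+n (suc (suc g)) (6 * x + 4)) (≤-reflexive (eq x)) ⟩
    8 * suc x              ≤⟨ *-monoʳ-≤ 8 (n<2^n x) ⟩
    8 * 2 ^ x              ≡⟨ trans (*-comm 8 (2 ^ x)) (2^-+ x 3) ⟩
    2 ^ (x + 3)            ∎
    where
    eq : ∀ x → suc (suc (x + x + 2)) + (6 * x + 4) ≡ 8 * suc x
    eq = solve-∀
  enough : 2 ^ x ≤ length (moduli n)
  enough = *-cancelˡ-≤ (suc (suc g)) (begin
    suc (suc g) * 2 ^ x                 ≤⟨ *-monoˡ-≤ (2 ^ x) linear ⟩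
    2 ^ (x + 3) * 2 ^ x                 ≡⟨ trans (2^-+ (x + 3) x) (cong (2 ^_) (eq x)) ⟩
    2 ^ suc g                           ≤⟨ many-moduli g ⟩
    suc (suc g) * length (moduli n)     ∎)
    where
    eq : ∀ x → x + 3 + x ≡ suc (x + x + 2)
    eq = solve-∀

-- Corners, the grid, and the link between `numCornerFree`, `c` and `cnt`.

∈-range⁺ : ∀ {N d} → 0 < d → d ≤ N → d ∈ range N
∈-range⁺ {N} {suc d} _ d≤ = ∈-map⁺ suc (∈-upTo⁺ d≤)

∈-range⁻ : ∀ {N d} → d ∈ range N → 0 < d × d ≤ N
∈-range⁻ d∈ with ∈-map⁻ suc d∈
... | _ , i∈ , refl = s≤s z≤n , ∈-upTo⁻ i∈

_≟V_ : ∀ {k} → DecidableEquality (Vec ℕ k)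
_≟V_ = VecP.≡-dec _≟_

cornerEdge : ∀ {k} → Vec ℕ k → ℕ → List (Vec ℕ k)
cornerEdge {k} a d = a ∷ map (λ i → shift a i d) (allFin k)

HasCorner : ∀ {k} → ℕ → List (Vec ℕ k) → Set
HasCorner N S = ∃[ a ] ∃[ d ] d ∈ range N × cornerEdge a d ⊆ S

∈ᵇ⇒∈ : ∀ {k} {v : Vec ℕ k} S → T (v ∈ᵇ S) → v ∈ S
∈ᵇ⇒∈ S t = Any.map toWitness (AnyP.any⁻ _ S t)

∈⇒∈ᵇ : ∀ {k} {v : Vec ℕ k} {S} → v ∈ S → T (v ∈ᵇ S)
∈⇒∈ᵇ v∈ = AnyP.any⁺ _ (Any.map fromWitness v∈)

hasCornerᵇ⇒HasCorner : ∀ {k} N (S : List (Vec ℕ k)) → T (hasCornerᵇ N S) → HasCorner N S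
hasCornerᵇ⇒HasCorner {k} N S t with find (AnyP.any⁻ _ S t)
... | a , a∈ , t' with find (AnyP.any⁻ (isCornerᵇ S a) (range N) t')
...   | d , d∈ , t'' with Equivalence.to (T-∧ {a ∈ᵇ S}) t''
...     | ta , ts = a , d , d∈ , sub
  where
  sub : cornerEdge a d ⊆ S
  sub (here refl) = a∈
  sub (there i) with ∈-map⁻ _ i
  ... | j , j∈ , refl = ∈ᵇ⇒∈ S (All.lookup (AllP.all⁺ _ (allFin k) ts) j∈)

HasCorner⇒hasCornerᵇ : ∀ {k} N (S : List (Vec ℕ k)) → HasCorner N S → T (hasCornerᵇ N S)
HasCorner⇒hasCornerᵇ {k} N S (a , d , d∈ , sub) =
  AnyP.any⁺ _ (lose (sub (here refl)) (AnyP.any⁺ (isCornerᵇ S a) (lose d∈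
    (Equivalence.from (T-∧ {a ∈ᵇ S}) (∈⇒∈ᵇ (sub (here refl)) ,
      AllP.all⁻ _ {xs = allFin k} (All.tabulate λ {i} i∈ → ∈⇒∈ᵇ (sub (there (∈-map⁺ _ i∈)))))))))

CornerFree : ∀ {k} → ℕ → List (Vec ℕ k) → Set
CornerFree N S = T (not (hasCornerᵇ N S))

¬T⇒Tnot : ∀ b → ¬ T b → T (not b)
¬T⇒Tnot true  ¬t = contradiction _ ¬t
¬T⇒Tnot false _  = _

Tnot⇒¬T : ∀ b → T (not b) → ¬ T b
Tnot⇒¬T false _ ()

cornerFree⁺ : ∀ {k} N (S : List (Vec ℕ k)) → ¬ HasCorner N S → CornerFree N S
cornerFree⁺ N S ¬h = ¬T⇒Tnot _ (¬h ∘ hasCornerᵇ⇒HasCorner N S)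

cornerFree⁻ : ∀ {k} N (S : List (Vec ℕ k)) → CornerFree N S → ¬ HasCorner N S
cornerFree⁻ N S cf = Tnot⇒¬T _ cf ∘ HasCorner⇒hasCornerᵇ N S

cornerFree? : ∀ {k} N → Decidable (CornerFree {k} N)
cornerFree? N S = T? _

cornerFree-antitone : ∀ {k} N {S S' : List (Vec ℕ k)} → S ⊆ S' → CornerFree N S' → CornerFree N S
cornerFree-antitone N {S} {S'} sub cf =
  cornerFree⁺ N S λ (a , d , d∈ , e⊆) → cornerFree⁻ N S' cf (a , d , d∈ , sub ∘ e⊆)

points-suc : ∀ k N → points (suc k) N ≡ cartesianProductWith _∷_ (range N) (points k N)
points-suc k N = go (range N)
  where
  go : ∀ xs → concatMap (λ x → map (x ∷_) (points k N)) xs ≡ cartesianProductWith _∷_ xs (points k N)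
  go []       = refl
  go (x ∷ xs) = cong (map (x ∷_) (points k N) ++_) (go xs)

length-cartesianProductWith : ∀ {A B C : Set} (f : A → B → C) xs ys →
  length (cartesianProductWith f xs ys) ≡ length xs * length ys
length-cartesianProductWith f []       ys = refl
length-cartesianProductWith f (x ∷ xs) ys = trans (length-++ (map (f x) ys))
  (cong₂ _+_ (length-map (f x) ys) (length-cartesianProductWith f xs ys))

length-range : ∀ N → length (range N) ≡ N
length-range N = trans (length-map suc (upTo N)) (length-upTo N)

length-points : ∀ k N → length (points k N) ≡ N ^ k
length-points zero    N = refl
length-points (suc k) N = trans (cong length (points-suc k N))
  (trans (length-cartesianProductWith _∷_ (range N) (points k N)) (cong₂ _*_ (length-range N) (length-points k N)))

unique-points : ∀ k N → Unique (points k N)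
unique-points zero    N = [] ∷ []
unique-points (suc k) N = subst Unique (sym (points-suc k N))
  (UniqueP.cartesianProductWith⁺ _∷_ VecP.∷-injective (UniqueP.map⁺ suc-injective (UniqueP.upTo⁺ N)) (unique-points k N))

∈-points⁻ : ∀ {k N} {v : Vec ℕ k} → v ∈ points k N → ∀ i → lookup v i ∈ range N
∈-points⁻ {suc k} {N} {v} v∈ i with ∈-cartesianProductWith⁻ _∷_ (range N) (points k N) (subst (v ∈_) (points-suc k N) v∈)
∈-points⁻ v∈ Fin.zero    | x , w , x∈ , w∈ , refl = x∈
∈-points⁻ v∈ (Fin.suc i) | x , w , x∈ , w∈ , refl = ∈-points⁻ w∈ i

filter∈sublists : {A : Set} {P : Pred A 0ℓ} (P? : Decidable P) (xs : List A) → filter P? xs ∈ sublists xs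
filter∈sublists P? []       = here refl
filter∈sublists P? (x ∷ xs) with P? x
... | yes _ = ∈-++⁺ʳ (sublists xs) (∈-map⁺ (x ∷_) (filter∈sublists P? xs))
... | no  _ = ∈-++⁺ˡ (filter∈sublists P? xs)

sublists-length : {A : Set} (xs : List A) {S : List A} → S ∈ sublists xs → length S ≤ length xs
sublists-length []       (here refl) = z≤n
sublists-length (x ∷ xs) S∈ with ∈-++⁻ (sublists xs) S∈
... | inj₁ S∈ˡ = m≤n⇒m≤1+n (sublists-length xs S∈ˡ)
... | inj₂ S∈ʳ with ∈-map⁻ (x ∷_) S∈ʳ
...   | S' , S'∈ , refl = s≤s (sublists-length xs S'∈)

∈⇒≤foldr⊔ : ∀ {m ms} → m ∈ ms → m ≤ foldr _⊔_ 0 ms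
∈⇒≤foldr⊔ {ms = n ∷ ms} (here refl) = m≤m⊔n n _
∈⇒≤foldr⊔ {ms = n ∷ ms} (there m∈)  = ≤-trans (∈⇒≤foldr⊔ m∈) (m≤n⊔m n _)

foldr⊔≤ : ∀ {b} ms → (∀ {m} → m ∈ ms → m ≤ b) → foldr _⊔_ 0 ms ≤ b
foldr⊔≤ []       h = z≤n
foldr⊔≤ (m ∷ ms) h = ⊔-lub (h (here refl)) (foldr⊔≤ ms (h ∘ there))

c≤N^k : ∀ k N → c k N ≤ N ^ k
c≤N^k k N = foldr⊔≤ (map length (cornerFreeSets k N)) bound
  where
  bound : ∀ {m} → m ∈ map length (cornerFreeSets k N) → m ≤ N ^ k
  bound m∈ with ∈-map⁻ length m∈
  ... | S , S∈ , refl = ≤-trans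
    (sublists-length (points k N) (proj₁ (∈-filter⁻ _ {xs = sublists (points k N)} S∈)))
    (≤-reflexive (length-points k N))

-- `c` ranges over sublists of `points k N` only; a filter of the grid is the form in which later
-- sets are presented to it.
length-filter≤c : ∀ {k N} {P : Pred (Vec ℕ k) 0ℓ} (P? : Decidable P) →
  ¬ HasCorner N (filter P? (points k N)) → length (filter P? (points k N)) ≤ c k N
length-filter≤c {k} {N} P? ¬corner = ∈⇒≤foldr⊔ (∈-map⁺ length
  (∈-filter⁺ _ (filter∈sublists P? (points k N)) (cornerFree⁺ N (filter P? (points k N)) ¬corner)))

module _ (k N : ℕ) where
  open Containers {Vec ℕ k} _≟V_ (CornerFree N) (cornerFree? N) (cornerFree-antitone N)

  -- `sublists` and `cnt` both branch on the head. In the induction `φ` absorbs the elements already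
  -- put into the sublist, while `T` records them for `cnt`.
  length-filterᵇ-sublists≤cnt : ∀ A T φ → (∀ S → Data.Bool.T (φ S) → CornerFree N (S ++ T)) →
    length (filterᵇ φ (sublists A)) ≤ cnt A T
  length-filterᵇ-sublists≤cnt [] T φ h with φ [] in eq
  ... | false = z≤n
  ... | true  = ≤-reflexive (sym (⟦⟧-yes (cornerFree? N T) (h [] (subst Data.Bool.T (sym eq) _))))
  length-filterᵇ-sublists≤cnt (x ∷ A) T φ h = begin
    length (filterᵇ φ (sublists A ++ map (x ∷_) (sublists A)))
      ≡⟨ cong length (filter-++ (T? ∘ φ) (sublists A) _) ⟩
    length (filterᵇ φ (sublists A) ++ filterᵇ φ (map (x ∷_) (sublists A)))
      ≡⟨ length-++ (filterᵇ φ (sublists A)) ⟩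
    length (filterᵇ φ (sublists A)) + length (filterᵇ φ (map (x ∷_) (sublists A)))
      ≡⟨ cong (length (filterᵇ φ (sublists A)) +_) (filter-map (sublists A)) ⟩
    length (filterᵇ φ (sublists A)) + length (filterᵇ (φ ∘ (x ∷_)) (sublists A))
      ≤⟨ +-mono-≤ (length-filterᵇ-sublists≤cnt A T φ h)
           (length-filterᵇ-sublists≤cnt A (x ∷ T) (φ ∘ (x ∷_)) (λ S t → cornerFree-antitone N (move S) (h (x ∷ S) t))) ⟩
    cnt A T + cnt A (x ∷ T) ∎
    where
    open ≤-Reasoning
    filter-map : ∀ xss → length (filterᵇ φ (map (x ∷_) xss)) ≡ length (filterᵇ (φ ∘ (x ∷_)) xss)
    filter-map xss = trans (length-filter≡∑ (T? ∘ φ) (map (x ∷_) xss))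
      (trans (∑-map (x ∷_) xss _) (sym (length-filter≡∑ (T? ∘ φ ∘ (x ∷_)) xss)))
    move : ∀ S → S ++ x ∷ T ⊆ x ∷ S ++ T
    move S i with ∈-++⁻ S i
    ... | inj₁ j           = there (∈-++⁺ˡ j)
    ... | inj₂ (here refl) = here refl
    ... | inj₂ (there j)   = there (∈-++⁺ʳ S j)

  numCornerFree≤cnt : numCornerFree k N ≤ cnt (points k N) []
  numCornerFree≤cnt = length-filterᵇ-sublists≤cnt (points k N) [] _
    (λ S t → cornerFree-antitone N (λ i → subst (_ ∈_) (++-identityʳ S) i) t)

-- Behrend's lower bound for `c`.

divMod-unique : ∀ {b a a' q q'} → a < b → a' < b → a + b * q ≡ a' + b * q' → a ≡ a' × q ≡ q'
divMod-unique {b@(suc _)} {a} {a'} {q} {q'} a< a'< eq = a≡a' ,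
  *-cancelˡ-≡ q q' b (+-cancelˡ-≡ a' (b * q) (b * q') (trans (cong (_+ b * q) (sym a≡a')) eq))
  where
  remainder : ∀ {a q} → a < b → (a + b * q) % b ≡ a
  remainder {a} {q} a< = trans (cong (λ z → (a + z) % b) (*-comm b q)) (trans ([m+kn]%n≡m%n a q b) (m<n⇒m%n≡m a<))
  a≡a' : a ≡ a'
  a≡a' = trans (sym (remainder {q = q} a<)) (trans (cong (_% b) eq) (remainder {q = q'} a'<))

-- If e is the common difference of the progression p, q, r, then p² + r² exceeds 2q² by exactly
-- 2e².
square-convex : ∀ {p q r} → p + r ≡ 2 * q →
  2 * (q * q) ≤ p * p + r * r × (p * p + r * r ≤ 2 * (q * q) → p ≡ q)
square-convex {p} {q} {r} eq with ≤-total p q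
... | inj₁ p≤q with m≤n⇒∃[o]m+o≡n p≤q
...   | e , refl with +-cancelˡ-≡ p r (p + (e + e)) (trans eq (eq₁ p e))
  where
  eq₁ : ∀ p e → 2 * (p + e) ≡ p + (p + (e + e))
  eq₁ = solve-∀
...     | refl = ≤-trans (m≤m+n _ (2 * (e * e))) (≤-reflexive (eq₂ p e))
               , λ le → strict e (+-cancelˡ-≤ (2 * ((p + e) * (p + e))) (2 * (e * e)) 0
                   (≤-trans (≤-reflexive (eq₂ p e)) (≤-trans le (≤-reflexive (sym (+-identityʳ _))))))
  where
  eq₂ : ∀ p e → 2 * ((p + e) * (p + e)) + 2 * (e * e) ≡ p * p + (p + (e + e)) * (p + (e + e))
  eq₂ = solve-∀
  strict : ∀ e → 2 * (e * e) ≤ 0 → p ≡ p + e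
  strict zero _ = sym (+-identityʳ p)
square-convex {p} {q} {r} eq | inj₂ q≤p with m≤n⇒∃[o]m+o≡n q≤p
...   | e , refl with +-cancelˡ-≡ (q + e) (r + e) q (trans (trans (sym (+-assoc (q + e) r e)) (cong (_+ e) eq)) (eq₁ q e))
  where
  eq₁ : ∀ q e → 2 * q + e ≡ q + e + q
  eq₁ = solve-∀
...     | refl = ≤-trans (m≤m+n _ (2 * (e * e))) (≤-reflexive (eq₂ r e))
               , λ le → strict e (+-cancelˡ-≤ (2 * ((r + e) * (r + e))) (2 * (e * e)) 0
                   (≤-trans (≤-reflexive (eq₂ r e)) (≤-trans le (≤-reflexive (sym (+-identityʳ _))))))
  where
  eq₂ : ∀ r e → 2 * ((r + e) * (r + e)) + 2 * (e * e) ≡ (r + e + e) * (r + e + e) + r * r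
  eq₂ = solve-∀
  strict : ∀ e → 2 * (e * e) ≤ 0 → r + e + e ≡ r + e
  strict zero _ = +-identityʳ (r + 0)

-- Behrend's construction.  A digit in base 2h is split into its top bit and its residue
-- mod h; fixing the top bits prevents carries between digits.
module Behrend (h : ℕ) {{_ : NonZero h}} where

  low top rest : ℕ → ℕ
  low  x = x % h
  top  x = (x / h) % 2
  rest x = x / h / 2

  split-digit : ∀ x → x ≡ low x + h * (top x + 2 * rest x)
  split-digit x = trans (m≡m%n+[m/n]*n x h) (cong (low x +_) (trans (*-comm (x / h) h)
    (cong (h *_) (trans (m≡m%n+[m/n]*n (x / h) 2) (cong (top x +_) (*-comm (x / h / 2) 2))))))

  tops : ℕ → ℕ → ℕ
  tops zero    x = 0
  tops (suc j) x = top x + 2 * tops j (rest x)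

  -- Squared length of the vector of low digits of x plus twice that of y: the form x + 2y turns a
  -- planar corner into a three-term progression, and a sphere contains no such progression except
  -- constant ones.
  norm : ℕ → ℕ → ℕ → ℕ
  norm zero    x y = 0
  norm (suc j) x y = (low x + 2 * low y) * (low x + 2 * low y) + norm j (rest x) (rest y)

  rest< : ∀ j {x} → x < (2 * h) ^ suc j → rest x < (2 * h) ^ j
  rest< j {x} x< = *-cancelˡ-< (2 * h) _ _ (≤-<-trans
    (≤-trans (m≤n+m (2 * h * rest x) (low x + h * top x)) (≤-reflexive (trans (eq (low x) h (top x) (rest x)) (sym (split-digit x))))) x<)
    where
    eq : ∀ l h t r → l + h * t + 2 * h * r ≡ l + h * (t + 2 * r)
    eq = solve-∀

  -- With u, v, u', v' the digits of x, y, x', y', the numbers u + 2v, u' + 2v, u + 2v'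
  -- form an arithmetic progression with middle term u' + 2v.
  norm-convex : ∀ j {x x' y y'} → x' + y ≡ x + y' → tops j x ≡ tops j x' → tops j y ≡ tops j y' →
    x < (2 * h) ^ j → x' < (2 * h) ^ j → y < (2 * h) ^ j → y' < (2 * h) ^ j →
    2 * norm j x' y ≤ norm j x y + norm j x y' ×
    (norm j x y + norm j x y' ≤ 2 * norm j x' y → x ≡ x')
  norm-convex zero    _ _ _ (s≤s z≤n) (s≤s z≤n) _ _ = z≤n , λ _ → refl
  norm-convex (suc j) {x} {x'} {y} {y'} sum-eq tx ty x< x'< y< y'<
    with divMod-unique (m%n<n (x / h) 2) (m%n<n (x' / h) 2) tx
       | divMod-unique (m%n<n (y / h) 2) (m%n<n (y' / h) 2) ty
  ... | tx₀ , tx' | ty₀ , ty'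
    with divMod-unique {2 * h} {low x' + low y} {low x + low y'} {rest x' + rest y} {rest x + rest y'}
           (low+low< x' y) (low+low< x y')
           (+-cancelʳ-≡ (h * (top x + top y)) _ _ (begin
             low x' + low y + 2 * h * (rest x' + rest y) + h * (top x + top y)
               ≡⟨ cong (λ t → low x' + low y + 2 * h * (rest x' + rest y) + h * (t + top y)) tx₀ ⟩
             low x' + low y + 2 * h * (rest x' + rest y) + h * (top x' + top y)
               ≡⟨ regroup (low x') (low y) h (rest x') (rest y) (top x') (top y) ⟩
             low x' + h * (top x' + 2 * rest x') + (low y + h * (top y + 2 * rest y))
               ≡⟨ cong₂ _+_ (sym (split-digit x')) (sym (split-digit y)) ⟩
             x' + y
               ≡⟨ sum-eq ⟩
             x + y'
               ≡⟨ cong₂ _+_ (split-digit x) (split-digit y') ⟩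
             low x + h * (top x + 2 * rest x) + (low y' + h * (top y' + 2 * rest y'))
               ≡⟨ sym (regroup (low x) (low y') h (rest x) (rest y') (top x) (top y')) ⟩
             low x + low y' + 2 * h * (rest x + rest y') + h * (top x + top y')
               ≡⟨ cong (λ t → low x + low y' + 2 * h * (rest x + rest y') + h * (top x + t)) (sym ty₀) ⟩
             low x + low y' + 2 * h * (rest x + rest y') + h * (top x + top y) ∎))
    where
    open ≡-Reasoning
    low+low< : ∀ x y → low x + low y < 2 * h
    low+low< x y = subst (low x + low y <_) (cong (h +_) (sym (+-identityʳ h))) (+-mono-< (m%n<n x h) (m%n<n y h))
    regroup : ∀ a b h r s t u → a + b + 2 * h * (r + s) + h * (t + u) ≡ a + h * (t + 2 * r) + (b + h * (u + 2 * s))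
    regroup = solve-∀
  ... | low-eq , rest-eq
    with square-convex {low x + 2 * low y} {low x' + 2 * low y} {low x + 2 * low y'} progression
       | norm-convex j rest-eq tx' ty' (rest< j x<) (rest< j x'<) (rest< j y<) (rest< j y'<)
    where
    open ≡-Reasoning
    progression : low x + 2 * low y + (low x + 2 * low y') ≡ 2 * (low x' + 2 * low y)
    progression = begin
      low x + 2 * low y + (low x + 2 * low y')  ≡⟨ eq₁ (low x) (low y) (low y') ⟩
      2 * (low x + low y') + 2 * low y          ≡⟨ cong (λ z → 2 * z + 2 * low y) (sym low-eq) ⟩
      2 * (low x' + low y) + 2 * low y          ≡⟨ eq₂ (low x') (low y) ⟩
      2 * (low x' + 2 * low y)                  ∎
      where
      eq₁ : ∀ a b c → a + 2 * b + (a + 2 * c) ≡ 2 * (a + c) + 2 * b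
      eq₁ = solve-∀
      eq₂ : ∀ a b → 2 * (a + b) + 2 * b ≡ 2 * (a + 2 * b)
      eq₂ = solve-∀
  ... | sq≤ , sq≡ | nm≤ , nm≡ = le , x≡x'
    where
    open ≤-Reasoning
    q² = (low x' + 2 * low y) * (low x' + 2 * low y)
    p² = (low x + 2 * low y) * (low x + 2 * low y)
    r² = (low x + 2 * low y') * (low x + 2 * low y')
    n₁ = norm j (rest x) (rest y)
    n₂ = norm j (rest x) (rest y')
    n₃ = norm j (rest x') (rest y)
    eqˡ : 2 * (q² + n₃) ≡ 2 * q² + 2 * n₃
    eqˡ = *-distribˡ-+ 2 q² n₃
    eqʳ : p² + n₁ + (r² + n₂) ≡ p² + r² + (n₁ + n₂)
    eqʳ = interchange p² n₁ r² n₂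
      where
      interchange : ∀ a b c d → a + b + (c + d) ≡ a + c + (b + d)
      interchange = solve-∀
    le : 2 * (q² + n₃) ≤ p² + n₁ + (r² + n₂)
    le = subst₂ _≤_ (sym eqˡ) (sym eqʳ) (+-mono-≤ sq≤ nm≤)
    x≡x' : p² + n₁ + (r² + n₂) ≤ 2 * (q² + n₃) → x ≡ x'
    x≡x' ge = begin-equality
      x                                     ≡⟨ split-digit x ⟩
      low x + h * (top x + 2 * rest x)      ≡⟨ cong₂ (λ l u → l + h * u) low≡ (cong₂ (λ t r → t + 2 * r) tx₀ rest≡) ⟩
      low x' + h * (top x' + 2 * rest x')   ≡⟨ sym (split-digit x') ⟩
      x'                                    ∎
      where
      ge' : p² + r² + (n₁ + n₂) ≤ 2 * q² + 2 * n₃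
      ge' = subst₂ _≤_ eqʳ eqˡ ge
      low≡ : low x ≡ low x'
      low≡ = +-cancelʳ-≡ (2 * low y) _ _ (sq≡ (+-cancelʳ-≤ (2 * n₃) _ _ (≤-trans (+-monoʳ-≤ (p² + r²) nm≤) ge')))
      rest≡ : rest x ≡ rest x'
      rest≡ = nm≡ (+-cancelˡ-≤ (2 * q²) _ _ (≤-trans (+-monoˡ-≤ (n₁ + n₂) sq≤) ge'))

  tops< : ∀ j x → tops j x < 2 ^ j
  tops< zero    x = s≤s z≤n
  tops< (suc j) x = begin-strict
    top x + 2 * tops j (rest x)   <⟨ +-monoˡ-< (2 * tops j (rest x)) (m%n<n (x / h) 2) ⟩
    2 + 2 * tops j (rest x)       ≡⟨ sym (*-suc 2 (tops j (rest x))) ⟩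
    2 * suc (tops j (rest x))     ≤⟨ *-monoʳ-≤ 2 (tops< j (rest x)) ⟩
    2 * 2 ^ j                     ∎
    where open ≤-Reasoning

  norm≤ : ∀ j x y → norm j x y ≤ j * (4 * h * (4 * h))
  norm≤ zero    x y = z≤n
  norm≤ (suc j) x y = +-mono-≤ (*-mono-≤ digit≤ digit≤) (norm≤ j (rest x) (rest y))
    where
    open ≤-Reasoning
    digit≤ : low x + 2 * low y ≤ 4 * h
    digit≤ = begin
      low x + 2 * low y   ≤⟨ +-mono-≤ (<⇒≤ (m%n<n x h)) (*-monoʳ-≤ 2 (<⇒≤ (m%n<n y h))) ⟩
      h + 2 * h           ≤⟨ m≤n+m (h + 2 * h) h ⟩
      h + (h + 2 * h)     ≡⟨ eq h ⟩
      4 * h               ∎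
      where
      eq : ∀ h → h + (h + 2 * h) ≡ 4 * h
      eq = solve-∀

  -- Two coordinates suffice, since a k-dimensional corner contains a planar one in the first two
  -- directions. Coordinates start at 1 but digit expansions at 0, hence `pred`.
  colour : ∀ {k} → ℕ → Vec ℕ (2 + k) → ℕ × ℕ × ℕ
  colour j (x ∷ y ∷ _) = tops j (pred x) , tops j (pred y) , norm j (pred x) (pred y)

  _≟C_ : DecidableEquality (ℕ × ℕ × ℕ)
  _≟C_ = ≡-dec _≟_ (≡-dec _≟_ _≟_)

  colour-class : ∀ {k} j → ℕ × ℕ × ℕ → List (Vec ℕ (2 + k))
  colour-class {k} j col = filter (λ x → colour j x ≟C col) (points (2 + k) ((2 * h) ^ j))

  -- On a monochromatic corner the norms agree, which is the equality case of `norm-convex` for x' =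
  -- x + d and y' = y + d and forces d = 0.
  colour-class-cornerFree : ∀ {k} j col → ¬ HasCorner ((2 * h) ^ j) (colour-class {k} j col)
  colour-class-cornerFree {k} j col (x ∷ y ∷ v , d , d∈ , sub)
    with member (here refl) | member (there (here refl)) | member (there (there (here refl)))
    where
    N = (2 * h) ^ j
    member : ∀ {z} → z ∈ cornerEdge (x ∷ y ∷ v) d → z ∈ points (2 + k) N × colour j z ≡ col
    member z∈ = ∈-filter⁻ (λ x → colour j x ≟C col) {xs = points (2 + k) N} (sub z∈)
  ... | a∈ , refl | b∈ , eq₁ | c∈ , eq₂ = no-corner x y
      (proj₁ (range⁻ a∈ Fin.zero)) (proj₁ (range⁻ a∈ (Fin.suc Fin.zero)))
      (proj₂ (range⁻ b∈ Fin.zero)) (proj₂ (range⁻ c∈ (Fin.suc Fin.zero))) (eq₁ , eq₂)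
    where
    N = (2 * h) ^ j
    range⁻ : ∀ {z : Vec ℕ (2 + k)} → z ∈ points (2 + k) N → ∀ i → 0 < lookup z i × lookup z i ≤ N
    range⁻ z∈ i = ∈-range⁻ (∈-points⁻ z∈ i)
    no-corner : ∀ x y → 0 < x → 0 < y → x + d ≤ N → y + d ≤ N →
      ¬ (colour j (x + d ∷ y ∷ v) ≡ colour j (x ∷ y ∷ v) ×
         colour j (x ∷ y + d ∷ v) ≡ colour j (x ∷ y ∷ v))
    no-corner (suc x) (suc y) _ _ x+d< y+d< (eq₁ , eq₂) =
      n>0⇒n≢0 (proj₁ (∈-range⁻ d∈)) (sym (+-cancelˡ-≡ x 0 d (trans (+-identityʳ x) x≡x+d)))
      where
      x≡x+d : x ≡ x + d
      x≡x+d = proj₂ (norm-convex j {x} {x + d} {y} {y + d} (trans (+-assoc x d y) (cong (x +_) (+-comm d y)))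
        (sym (,-injectiveˡ eq₁)) (sym (,-injectiveˡ (,-injectiveʳ eq₂)))
        (≤-trans (s≤s (m≤m+n x d)) x+d<) x+d< (≤-trans (s≤s (m≤m+n y d)) y+d<) y+d<)
        (≤-reflexive (begin
          norm j x y + norm j x (y + d)   ≡⟨ cong (norm j x y +_) (,-injectiveʳ (,-injectiveʳ eq₂)) ⟩
          norm j x y + norm j x y         ≡⟨ cong (norm j x y +_) (sym (+-identityʳ _)) ⟩
          2 * norm j x y                  ≡⟨ cong (2 *_) (sym (,-injectiveʳ (,-injectiveʳ eq₁))) ⟩
          2 * norm j (x + d) y            ∎))
        where open ≡-Reasoning

  -- The colour classes cover the grid and each has at most `c` points; the remaining factor counts
  -- the possible colours.
  N^k≤colours*c : ∀ k j → ((2 * h) ^ j) ^ (2 + k)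
    ≤ 2 ^ j * (2 ^ j * suc (j * (4 * h * (4 * h)))) * c (2 + k) ((2 * h) ^ j)
  N^k≤colours*c k j = begin
    N ^ (2 + k)
      ≡⟨ sym (length-points (2 + k) N) ⟩
    length (points (2 + k) N)
      ≡⟨ length≡∑ (points (2 + k) N) ⟩
    ∑ (points (2 + k) N) (λ _ → 1)
      ≤⟨ ∑-mono (points (2 + k) N) (λ {x} _ → ≤-trans (≤-reflexive (sym (⟦⟧-yes (colour j x ≟C colour j x) refl)))
           (∈⇒≤∑ (λ col → ⟦ colour j x ≟C col ⟧) (colour∈ x))) ⟩
    ∑ (points (2 + k) N) (λ x → ∑ colours (λ col → ⟦ colour j x ≟C col ⟧))
      ≡⟨ ∑-swap (points (2 + k) N) colours _ ⟩
    ∑ colours (λ col → ∑ (points (2 + k) N) (λ x → ⟦ colour j x ≟C col ⟧))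
      ≡⟨ ∑-cong colours (λ col → sym (length-filter≡∑ (λ x → colour j x ≟C col) (points (2 + k) N))) ⟩
    ∑ colours (λ col → length (colour-class {k} j col))
      ≤⟨ ∑-mono colours (λ {col} _ → length-filter≤c (λ x → colour j x ≟C col) (colour-class-cornerFree j col)) ⟩
    ∑ colours (λ _ → c (2 + k) N)
      ≡⟨ ∑-const colours (c (2 + k) N) ⟩
    length colours * c (2 + k) N
      ≡⟨ cong (_* c (2 + k) N) length-colours ⟩
    2 ^ j * (2 ^ j * suc (j * (4 * h * (4 * h)))) * c (2 + k) N ∎
    where
    open ≤-Reasoning
    N = (2 * h) ^ j
    colours = cartesianProduct (upTo (2 ^ j)) (cartesianProduct (upTo (2 ^ j)) (upTo (suc (j * (4 * h * (4 * h))))))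
    length-colours : length colours ≡ 2 ^ j * (2 ^ j * suc (j * (4 * h * (4 * h))))
    length-colours = trans (length-cartesianProductWith _,_ (upTo (2 ^ j)) _)
      (cong₂ _*_ (length-upTo (2 ^ j)) (trans (length-cartesianProductWith _,_ (upTo (2 ^ j)) _)
        (cong₂ _*_ (length-upTo (2 ^ j)) (length-upTo _))))
    colour∈ : ∀ x → colour j x ∈ colours
    colour∈ (x ∷ y ∷ _) = ∈-cartesianProduct⁺ (∈-upTo⁺ (tops< j (pred x)))
      (∈-cartesianProduct⁺ (∈-upTo⁺ (tops< j (pred y))) (∈-upTo⁺ (s≤s (norm≤ j (pred x) (pred y)))))

-- Taken with m digits in base 2^m, that is h = 2^(m-1). Of the exponent 7m, the two vectors of top
-- bits use 2m and the norm uses 5m.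
N^k≤2^*c : ∀ k m → 2 ≤ k → 0 < m → (2 ^ (m * m)) ^ k ≤ 2 ^ (7 * m) * c k (2 ^ (m * m))
N^k≤2^*c (suc zero) (suc g) (s≤s ()) _
N^k≤2^*c (suc (suc k)) (suc g) _ _ = subst (λ N → N ^ (2 + k) ≤ 2 ^ (7 * m) * c (2 + k) N) (^-*-assoc 2 m m)
  (≤-trans (Behrend.N^k≤colours*c (2 ^ g) {{m^n≢0 2 g}} k m) (*-monoˡ-≤ (c (2 + k) ((2 ^ m) ^ m)) colours≤))
  where
  open ≤-Reasoning
  m = suc g
  norms≤ : suc (m * (4 * 2 ^ g * (4 * 2 ^ g))) ≤ 2 ^ (5 * m)
  norms≤ = begin
    suc (m * (4 * 2 ^ g * (4 * 2 ^ g)))      ≤⟨ s≤s (*-monoʳ-≤ m (≤-reflexive fourth)) ⟩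
    suc (m * 2 ^ (4 + g + g))                ≤⟨ +-monoˡ-≤ (m * 2 ^ (4 + g + g)) (2^>0 (4 + g + g)) ⟩
    suc m * 2 ^ (4 + g + g)                  ≤⟨ *-monoˡ-≤ (2 ^ (4 + g + g)) (n<2^n m) ⟩
    2 ^ m * 2 ^ (4 + g + g)                  ≡⟨ 2^-+ m (4 + g + g) ⟩
    2 ^ (m + (4 + g + g))                    ≤⟨ 2^-mono (≤-trans (m≤m+n (m + (4 + g + g)) (2 * g)) (≤-reflexive (eq g))) ⟩
    2 ^ (5 * m)                              ∎
    where
    eq : ∀ g → suc g + (4 + g + g) + 2 * g ≡ 5 * suc g
    eq = solve-∀
    fourth : 4 * 2 ^ g * (4 * 2 ^ g) ≡ 2 ^ (4 + g + g)
    fourth = trans (eq' (2 ^ g)) (trans (cong (16 *_) (2^-+ g g)) (2^-+ 4 (g + g)))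
      where
      eq' : ∀ x → 4 * x * (4 * x) ≡ 16 * (x * x)
      eq' = solve-∀
  colours≤ : 2 ^ m * (2 ^ m * suc (m * (4 * 2 ^ g * (4 * 2 ^ g)))) ≤ 2 ^ (7 * m)
  colours≤ = begin
    2 ^ m * (2 ^ m * suc (m * (4 * 2 ^ g * (4 * 2 ^ g))))   ≤⟨ *-monoʳ-≤ (2 ^ m) (*-monoʳ-≤ (2 ^ m) norms≤) ⟩
    2 ^ m * (2 ^ m * 2 ^ (5 * m))                           ≡⟨ trans (cong (2 ^ m *_) (2^-+ m (5 * m))) (2^-+ m (m + 5 * m)) ⟩
    2 ^ (m + (m + 5 * m))                                   ≡⟨⟩
    2 ^ (7 * m)                                             ∎

-- Dilated copies of the small grid inside the large one.

cube : ∀ k → List ℕ → List (Vec ℕ k)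
cube zero    xs = [ [] ]
cube (suc k) xs = cartesianProductWith _∷_ xs (cube k xs)

length-cube : ∀ k xs → length (cube k xs) ≡ length xs ^ k
length-cube zero    xs = refl
length-cube (suc k) xs = trans (length-cartesianProductWith _∷_ xs (cube k xs)) (cong (length xs *_) (length-cube k xs))

module _ {k : ℕ} where
  open UniqueLists {Vec ℕ k} _≟V_ public

QCorner : ∀ {k} → ℕ → ℕ → List (Vec ℕ k) → Set
QCorner N q A = ∃[ a ] ∃[ d ] d ∈ range N × q ∣ d × cornerEdge a d ⊆ A

qCorner? : ∀ {k} N q (A : List (Vec ℕ k)) → Dec (QCorner N q A)
qCorner? N q A with any? (λ a → any? (λ d → (q ∣? d) ×-dec All.all? (_∈? A) (cornerEdge a d)) (range N)) A
... | no ¬any = no λ (a , d , d∈ , q∣d , sub) →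
  ¬any (lose (sub (here refl)) (lose d∈ (q∣d , All.tabulate sub)))
... | yes any with find any
...   | a , _ , any' with find any'
...     | d , d∈ , q∣d , all = yes (a , d , d∈ , q∣d , All.lookup all)

module Dilation (k M Q q : ℕ) {{_ : NonZero M}} {{_ : NonZero q}} (q≤Q : q ≤ Q) where

  dilate : ℕ → ℕ → ℕ
  dilate u y = u + q * pred y

  -- First terms of progressions of length M and difference q: ρ is the residue class and z numbers
  -- the blocks of q M consecutive integers. The last block may stick out of [Q M], which costs the
  -- factor 2 below.
  offsets : List ℕ
  offsets = cartesianProductWith (λ z ρ → suc (ρ + q * M * z)) (upTo (suc (Q / q))) (upTo q)

  length-offsets≤ : length offsets ≤ 2 * Q
  length-offsets≤ = begin
    length offsets       ≡⟨ trans (length-cartesianProductWith _ (upTo (suc (Q / q))) (upTo q))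
                              (cong₂ _*_ (length-upTo (suc (Q / q))) (length-upTo q)) ⟩
    q + Q / q * q        ≤⟨ +-mono-≤ q≤Q (m/n*n≤m Q q) ⟩
    Q + Q                ≡⟨ cong (Q +_) (sym (+-identityʳ Q)) ⟩
    2 * Q                ∎
    where open ≤-Reasoning

  dilate-covers : ∀ {x} → x ∈ range (Q * M) → ∃[ u ] ∃[ y ] u ∈ offsets × y ∈ range M × dilate u y ≡ x
  dilate-covers x∈ with ∈-range⁻ x∈
  dilate-covers {suc x} x∈ | _ , x< = suc (x % q + q * M * (x / q / M)) , suc (x / q % M)
    , ∈-cartesianProductWith⁺ _ (∈-upTo⁺ (s≤s z≤)) (∈-upTo⁺ (m%n<n x q))
    , ∈-range⁺ (s≤s z≤n) (m%n<n (x / q) M)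
    , cong suc (sym x≡)
    where
    x≡ : x ≡ x % q + q * M * (x / q / M) + q * (x / q % M)
    x≡ = trans (m≡m%n+[m/n]*n x q) (trans (cong (λ z → x % q + z * q) (m≡m%n+[m/n]*n (x / q) M))
           (eq (x % q) (x / q % M) (x / q / M) M q))
      where
      eq : ∀ ρ y z M q → ρ + (y + z * M) * q ≡ ρ + q * M * z + q * y
      eq = solve-∀
    z≤ : x / q / M ≤ Q / q
    z≤ = ≤-trans (≤-reflexive (m/n/o≡m/[n*o]' x)) (/-monoˡ-≤ q (<⇒≤ (m<n*o⇒m/o<n x<)))
      where
      m/n/o≡m/[n*o]' : ∀ x → x / q / M ≡ x / M / q
      m/n/o≡m/[n*o]' x = trans (m/n/o≡m/[n*o] x q M {{_}} {{_}} {{m*n≢0 q M}})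
        (trans (/-congʳ {o = M * q} {{m*n≢0 q M}} {{m*n≢0 M q}} (*-comm q M))
          (sym (m/n/o≡m/[n*o] x M q {{_}} {{_}} {{m*n≢0 M q}})))

  dilateV : ∀ {k} → Vec ℕ k → Vec ℕ k → Vec ℕ k
  dilateV = zipWith dilate

  dilateV-covers : ∀ {k} (x : Vec ℕ k) → (∀ i → lookup x i ∈ range (Q * M)) →
    ∃[ u ] ∃[ y ] u ∈ cube k offsets × y ∈ points k M × dilateV u y ≡ x
  dilateV-covers [] _ = [] , [] , here refl , here refl , refl
  dilateV-covers {suc k} (x ∷ xs) x∈ with dilate-covers (x∈ Fin.zero) | dilateV-covers xs (x∈ ∘ Fin.suc)
  ... | u , y , u∈ , y∈ , refl | us , ys , us∈ , ys∈ , refl = u ∷ us , y ∷ ys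
    , ∈-cartesianProductWith⁺ _∷_ u∈ us∈
    , subst (y ∷ ys ∈_) (sym (points-suc k M)) (∈-cartesianProductWith⁺ _∷_ y∈ ys∈)
    , refl

  -- Positivity of the shifted coordinate makes `pred` commute with adding d.
  dilateV-shift : ∀ {k} (u a : Vec ℕ k) i d → 0 < lookup a i →
    dilateV u (shift a i d) ≡ shift (dilateV u a) i (q * d)
  dilateV-shift (u ∷ us) (suc y ∷ ys) Fin.zero d _ =
    cong (_∷ dilateV us ys) (trans (cong (u +_) (*-distribˡ-+ q y d)) (sym (+-assoc u (q * y) (q * d))))
  dilateV-shift (u ∷ us) (y ∷ ys) (Fin.suc i) d 0< = cong (dilate u y ∷_) (dilateV-shift us ys i d 0<)

  -- On each of the at most (2Q)^k dilated copies of [M]^k the trace of B is corner-free, because a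
  -- corner of the trace dilates to a corner of B whose difference is a multiple of q.
  ¬QCorner⇒length≤ : ∀ {B} → Unique B → B ⊆ points k (Q * M) → ¬ QCorner (Q * M) q B →
    length B ≤ (2 * Q) ^ k * c k M
  ¬QCorner⇒length≤ {B} uniq sub ¬corner = begin
    length B
      ≡⟨ length≡∑ B ⟩
    ∑ B (λ _ → 1)
      ≤⟨ ∑-mono B covered ⟩
    ∑ B (λ b → ∑ us (λ u → ∑ ys (λ y → ⟦ b ≟V dilateV u y ⟧)))
      ≡⟨ trans (∑-swap B us _) (∑-cong us (λ u → ∑-swap B ys _)) ⟩
    ∑ us (λ u → ∑ ys (λ y → ∑ B (λ b → ⟦ b ≟V dilateV u y ⟧)))
      ≤⟨ ∑-mono us (λ {u} _ → ∑-mono ys (λ {y} _ → ∑-≟≤∈? (dilateV u y) uniq)) ⟩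
    ∑ us (λ u → ∑ ys (λ y → ⟦ dilateV u y ∈? B ⟧))
      ≡⟨ ∑-cong us (λ u → sym (length-filter≡∑ (λ y → dilateV u y ∈? B) ys)) ⟩
    ∑ us (λ u → length (filter (λ y → dilateV u y ∈? B) ys))
      ≤⟨ ∑-mono us (λ {u} _ → length-filter≤c (λ y → dilateV u y ∈? B) (pull-back u)) ⟩
    ∑ us (λ _ → c k M)
      ≡⟨ ∑-const us (c k M) ⟩
    length us * c k M
      ≡⟨ cong (_* c k M) (length-cube k offsets) ⟩
    length offsets ^ k * c k M
      ≤⟨ *-monoˡ-≤ (c k M) (^-monoˡ-≤ k length-offsets≤) ⟩
    (2 * Q) ^ k * c k M ∎
    where
    open ≤-Reasoning
    us = cube k offsets
    ys = points k M
    covered : ∀ {b} → b ∈ B → 1 ≤ ∑ us (λ u → ∑ ys (λ y → ⟦ b ≟V dilateV u y ⟧))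
    covered {b} b∈ with dilateV-covers b (∈-points⁻ (sub b∈))
    ... | u , y , u∈ , y∈ , eq = ≤-trans (≤-reflexive (sym (⟦⟧-yes (b ≟V dilateV u y) (sym eq))))
      (≤-trans (∈⇒≤∑ (λ y → ⟦ b ≟V dilateV u y ⟧) y∈)
               (∈⇒≤∑ (λ u → ∑ ys (λ y → ⟦ b ≟V dilateV u y ⟧)) u∈))
    pull-back : ∀ u → ¬ HasCorner M (filter (λ y → dilateV u y ∈? B) ys)
    pull-back u (a , d , d∈ , e⊆) = ¬corner (dilateV u a , q * d , q*d∈ , m∣m*n d , dilated)
      where
      q*d∈ : q * d ∈ range (Q * M)
      q*d∈ = let 0<d , d≤M = ∈-range⁻ d∈ in ∈-range⁺ (*-mono-≤ (>-nonZero⁻¹ q) 0<d) (*-mono-≤ q≤Q d≤M)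
      member : ∀ {z} → z ∈ cornerEdge a d → z ∈ ys × dilateV u z ∈ B
      member z∈ = ∈-filter⁻ (λ y → dilateV u y ∈? B) {xs = ys} (e⊆ z∈)
      dilated : cornerEdge (dilateV u a) (q * d) ⊆ B
      dilated (here refl) = proj₂ (member (here refl))
      dilated (there z∈) with ∈-map⁻ _ z∈
      ... | i , i∈ , refl = subst (_∈ B)
        (dilateV-shift u a i d (proj₁ (∈-range⁻ (∈-points⁻ (proj₁ (member (here refl))) i))))
        (proj₂ (member (there (∈-map⁺ _ i∈))))

-- Supersaturation with small codegrees.

-- The l1 distance condenses congruence in all coordinates into divisibility of a single positive
-- integer, to which the sparsity of the moduli applies.
dist : ∀ {k} → Vec ℕ k → Vec ℕ k → ℕ
dist []      []      = 0
dist (x ∷ u) (y ∷ v) = ∣ x - y ∣ + dist u v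

dist>0 : ∀ {k} {u v : Vec ℕ k} → u ≢ v → 0 < dist u v
dist>0 u≢v = n≢0⇒n>0 (u≢v ∘ dist≡0 _ _)
  where
  dist≡0 : ∀ {k} (u v : Vec ℕ k) → dist u v ≡ 0 → u ≡ v
  dist≡0 []      []      _  = refl
  dist≡0 (x ∷ u) (y ∷ v) eq = cong₂ _∷_ (∣m-n∣≡0⇒m≡n (m+n≡0⇒m≡0 _ eq)) (dist≡0 u v (m+n≡0⇒n≡0 ∣ x - y ∣ eq))

dist≤ : ∀ {k N} (u v : Vec ℕ k) → (∀ i → lookup u i ≤ N) → (∀ i → lookup v i ≤ N) → dist u v ≤ k * N
dist≤ []      []      _  _  = z≤n
dist≤ (x ∷ u) (y ∷ v) u≤ v≤ = +-mono-≤ (≤-trans (∣m-n∣≤m⊔n x y) (⊔-lub (u≤ Fin.zero) (v≤ Fin.zero)))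
  (dist≤ u v (u≤ ∘ Fin.suc) (v≤ ∘ Fin.suc))

∣dist : ∀ {k q} {{_ : NonZero q}} (u v : Vec ℕ k) → (∀ i → lookup u i % q ≡ lookup v i % q) → q ∣ dist u v
∣dist         []      []      _   = _ ∣0
∣dist {q = q} (x ∷ u) (y ∷ v) res = ∣m∣n⇒∣m+n q∣ (∣dist u v (res ∘ Fin.suc))
  where
  q∣ : q ∣ ∣ x - y ∣
  q∣ = divides ∣ x / q - y / q ∣ (begin
    ∣ x - y ∣                                        ≡⟨ cong₂ ∣_-_∣ (m≡m%n+[m/n]*n x q) (m≡m%n+[m/n]*n y q) ⟩
    ∣ x % q + x / q * q - (y % q + y / q * q) ∣      ≡⟨ cong (λ r → ∣ x % q + x / q * q - (r + y / q * q) ∣) (sym (res Fin.zero)) ⟩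
    ∣ x % q + x / q * q - (x % q + y / q * q) ∣      ≡⟨ ∣m+n-m+o∣≡∣n-o∣ (x % q) (x / q * q) (y / q * q) ⟩
    ∣ x / q * q - y / q * q ∣                        ≡⟨ sym (*-distribʳ-∣-∣ q (x / q) (y / q)) ⟩
    ∣ x / q - y / q ∣ * q                            ∎)
    where open ≡-Reasoning

cornerEdge-residue : ∀ {k q d} {{_ : NonZero q}} {a w : Vec ℕ k} → q ∣ d → w ∈ cornerEdge a d →
  ∀ j → lookup w j % q ≡ lookup a j % q
cornerEdge-residue _ (here refl) j = refl
cornerEdge-residue {q = q} {a = a} (divides m refl) (there w∈) j with ∈-map⁻ _ w∈
... | i , _ , refl with j FinP.≟ i
...   | yes refl = trans (cong (_% q) (VecP.lookup∘updateAt i a)) ([m+kn]%n≡m%n (lookup a i) m q)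
...   | no  j≢i  = cong (_% q) (VecP.lookup∘updateAt′ j i j≢i a)

length-cornerEdge : ∀ {k} (a : Vec ℕ k) d → length (cornerEdge a d) ≡ suc k
length-cornerEdge {k} a d = cong suc (trans (length-map _ (allFin k)) (length-tabulate id))

module Supersaturation (k N : ℕ) where
  open Containers {Vec ℕ k} _≟V_ (CornerFree N) (cornerFree? N) (cornerFree-antitone N)

  QEdge : ℕ → List (Vec ℕ k) → Set
  QEdge q e = ∃[ a ] ∃[ d ] d ∈ range N × q ∣ d × e ≡ cornerEdge a d

  length≤length-filter-∉ : ∀ {A} (e : List (Vec ℕ k)) → Unique A → length A ≤ length (filter (λ u → ¬? (u ∈? e)) A) + length e
  length≤length-filter-∉ {A} e uniq = begin
    length A
      ≡⟨ length≡∑ A ⟩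
    ∑ A (λ _ → 1)
      ≤⟨ ∑-mono A (λ {u} _ → cover u) ⟩
    ∑ A (λ u → ⟦ ¬? (u ∈? e) ⟧ + ⟦ u ∈? e ⟧)
      ≡⟨ ∑-+ A _ _ ⟩
    ∑ A (λ u → ⟦ ¬? (u ∈? e) ⟧) + ∑ A (λ u → ⟦ u ∈? e ⟧)
      ≤⟨ +-mono-≤ (≤-reflexive (sym (length-filter≡∑ (λ u → ¬? (u ∈? e)) A))) (∑-∈?≤length e uniq) ⟩
    length (filter (λ u → ¬? (u ∈? e)) A) + length e ∎
    where
    open ≤-Reasoning
    cover : ∀ u → 1 ≤ ⟦ ¬? (u ∈? e) ⟧ + ⟦ u ∈? e ⟧
    cover u with u ∈? e
    ... | yes _ = ≤-refl
    ... | no  _ = ≤-refl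

  -- Greedy choice: each corner taken removes its k + 1 points, until the remainder `B` has no
  -- corner with difference divisible by q. `fuel` makes the recursion structural.
  disjoint-corners : ∀ q fuel {A} → Unique A → length A ≤ fuel → ∃[ F ] ∃[ B ]
    (∀ {e} → e ∈ F → e ⊆ A × QEdge q e) × (∀ v → deg F v ≤ 1) ×
    Unique B × B ⊆ A × ¬ QCorner N q B × length A ≤ length F * suc k + length B
  disjoint-corners q fuel {A} uniq A≤ with qCorner? N q A
  disjoint-corners q fuel {A} uniq A≤ | no ¬corner =
    [] , A , (λ ()) , (λ _ → z≤n) , uniq , id , ¬corner , ≤-refl
  disjoint-corners q zero {[]} uniq A≤ | yes (a , d , d∈ , q∣d , e⊆A) = contradiction (e⊆A (here refl)) λ ()
  disjoint-corners q (suc fuel) {A} uniq A≤ | yes (a , d , d∈ , q∣d , e⊆A)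
    with disjoint-corners q fuel {filter (λ u → ¬? (u ∈? cornerEdge a d)) A} (UniqueP.filter⁺ _ uniq)
           (s≤s⁻¹ (≤-trans (filter-notAll (λ u → ¬? (u ∈? cornerEdge a d)) A (lose (e⊆A (here refl)) λ ∉e → ∉e (here refl))) A≤))
  ... | F , B , edges , deg≤ , uniqB , B⊆ , ¬corner , size =
    e ∷ F , B , edges' , deg≤' , uniqB , proj₁ ∘ A'⁻ ∘ B⊆ , ¬corner , (begin
      length A
        ≤⟨ length≤length-filter-∉ e uniq ⟩
      length A' + length e
        ≤⟨ +-mono-≤ size (≤-reflexive (length-cornerEdge a d)) ⟩
      length F * suc k + length B + suc k
        ≡⟨ rearrange (length F * suc k) (length B) (suc k) ⟩
      suc k + length F * suc k + length B ∎)
    where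
    open ≤-Reasoning
    e = cornerEdge a d
    A' = filter (λ u → ¬? (u ∈? e)) A
    A'⁻ : ∀ {u} → u ∈ A' → u ∈ A × u ∉ e
    A'⁻ = ∈-filter⁻ (λ u → ¬? (u ∈? e)) {xs = A}
    rearrange : ∀ f b s → f + b + s ≡ s + f + b
    rearrange = solve-∀
    edges' : ∀ {e'} → e' ∈ e ∷ F → e' ⊆ A × QEdge q e'
    edges' (here refl) = e⊆A , a , d , d∈ , q∣d , refl
    edges' (there e'∈) = let e'⊆ , qe = edges e'∈ in proj₁ ∘ A'⁻ ∘ e'⊆ , qe
    deg≤' : ∀ v → deg (e ∷ F) v ≤ 1
    deg≤' v with v ∈? e
    ... | no  _   = deg≤ v
    ... | yes v∈e = s≤s (avoid⇒deg≡0 F v λ e'∈ v∈e' → proj₂ (A'⁻ (proj₁ (edges e'∈) v∈e')) v∈e)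

  codeg≤deg : ∀ H u v → codeg H u v ≤ deg H u
  codeg≤deg H u v = ∑-mono H λ {e} _ → ≤-trans (*-monoʳ-≤ ⟦ u ∈? e ⟧ (⟦⟧≤1 (v ∈? e))) (≤-reflexive (*-identityʳ _))

  module _ {M Q l qs} (0<M : 0 < M) (N≡ : N ≡ Q * M) (kN< : k * N < 2 ^ l)
    (qs-bounds : ∀ {q} → q ∈ qs → 0 < q × q ≤ Q)
    (qs-sparse : ∀ {d} → 0 < d → d < 2 ^ l → ∑ qs (λ q → ⟦ q ∣? d ⟧) ≤ l) where

    supersaturated : ∀ {A} → Unique A → A ⊆ points k N → 2 * ((2 * Q) ^ k * c k M) < length A →
      ∃[ H ] Hypergraph A [] (suc k) H × (∀ v → deg H v ≤ length qs) ×
             (∀ {u v} → u ≢ v → codeg H u v ≤ l) × length qs * length A ≤ 2 * suc k * length H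
    supersaturated {A} uniq sub large = H , hyp , deg≤ , codeg≤ , size
      where
      open ≤-Reasoning
      family = λ q → disjoint-corners q (length A) {A} uniq ≤-refl
      F = λ q → proj₁ (family q)
      F-edges : ∀ q {e} → e ∈ F q → e ⊆ A × QEdge q e
      F-edges q = proj₁ (proj₂ (proj₂ (family q)))
      F-deg : ∀ q v → deg (F q) v ≤ 1
      F-deg q = proj₁ (proj₂ (proj₂ (proj₂ (family q))))
      -- A corner chosen for several moduli is repeated in `H`; sizes, degrees and codegrees all
      -- count it with the same multiplicity.
      H = concat (map F qs)
      ∑-H : ∀ f → ∑ H f ≡ ∑ qs (λ q → ∑ (F q) f)
      ∑-H f = trans (∑-concat (map F qs) f) (∑-map F qs _)
      ∈-H : ∀ {e} → e ∈ H → ∃[ q ] e ∈ F q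
      ∈-H e∈ with ∈-concat⁻′ (map F qs) e∈
      ... | _ , e∈' , F∈ with ∈-map⁻ F F∈
      ...   | q , _ , refl = q , e∈'
      hyp : Hypergraph A [] (suc k) H
      hyp = record
        { short  = λ e∈ → let q , e∈F = ∈-H e∈ ; _ , a , d , _ , _ , eq = F-edges q e∈F
                          in ≤-reflexive (trans (cong length eq) (length-cornerEdge a d))
        ; inside = λ e∈ → let q , e∈F = ∈-H e∈ in proj₁ (F-edges q e∈F)
        ; bad    = λ {e} e∈ cf → let q , e∈F = ∈-H e∈ ; _ , a , d , d∈ , _ , eq = F-edges q e∈F
                          in cornerFree⁻ N _ cf (a , d , d∈ , λ {z} i → ∈-++⁺ˡ {xs = e} (subst (z ∈_) (sym eq) i))
        }
      deg≤ : ∀ v → deg H v ≤ length qs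
      deg≤ v = begin
        deg H v                        ≡⟨ ∑-H _ ⟩
        ∑ qs (λ q → deg (F q) v)       ≤⟨ ∑-mono qs (λ {q} _ → F-deg q v) ⟩
        ∑ qs (λ _ → 1)                 ≡⟨ sym (length≡∑ qs) ⟩
        length qs                      ∎
      -- The bound on the distance needs both points in the grid; a vertex off the grid lies in no
      -- edge.
      outside : ∀ u v → u ∉ points k N → codeg H u v ≤ 0
      outside u v u∉ = ≤-trans (codeg≤deg H u v)
        (avoid⇒deg≡0 H u λ e∈ u∈e → u∉ (sub (proj₁ (F-edges (proj₁ (∈-H e∈)) (proj₂ (∈-H e∈))) u∈e)))
      codeg-comm : ∀ u v → codeg H u v ≡ codeg H v u
      codeg-comm u v = ∑-cong H λ e → *-comm ⟦ u ∈? e ⟧ ⟦ v ∈? e ⟧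
      codeg-F : ∀ {q} u v → q ∈ qs → codeg (F q) u v ≤ ⟦ q ∣? dist u v ⟧
      codeg-F {q} u v q∈ with q ∣? dist u v
      ... | yes _ = ≤-trans (codeg≤deg (F q) u v) (F-deg q u)
      ... | no q∤ = ≤-trans (∑-mono (F q) {g = λ _ → 0} none) (≤-reflexive (trans (∑-const (F q) 0) (*-zeroʳ (length (F q)))))
        where
        instance
          q≢0 : NonZero q
          q≢0 = >-nonZero (proj₁ (qs-bounds q∈))
        none : ∀ {e} → e ∈ F q → ⟦ u ∈? e ⟧ * ⟦ v ∈? e ⟧ ≤ 0
        none {e} e∈ with u ∈? e | v ∈? e
        ... | no _    | _       = z≤n
        ... | yes _   | no _    = z≤n
        ... | yes u∈e | yes v∈e with F-edges q e∈
        ...   | _ , a , d , _ , q∣d , refl = contradiction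
          (∣dist u v λ i → trans (cornerEdge-residue q∣d u∈e i) (sym (cornerEdge-residue q∣d v∈e i))) q∤
      codeg≤ : ∀ {u v} → u ≢ v → codeg H u v ≤ l
      codeg≤ {u} {v} u≢v with u ∈? points k N | v ∈? points k N
      ... | no u∉  | _      = ≤-trans (outside u v u∉) z≤n
      ... | yes _  | no v∉  = ≤-trans (≤-reflexive (codeg-comm u v)) (≤-trans (outside v u v∉) z≤n)
      ... | yes u∈ | yes v∈ = begin
        codeg H u v                         ≡⟨ ∑-H _ ⟩
        ∑ qs (λ q → codeg (F q) u v)        ≤⟨ ∑-mono qs (codeg-F u v) ⟩
        ∑ qs (λ q → ⟦ q ∣? dist u v ⟧)      ≤⟨ qs-sparse (dist>0 u≢v) (≤-<-trans
                                                 (dist≤ u v (λ i → proj₂ (∈-range⁻ (∈-points⁻ u∈ i))) (λ i → proj₂ (∈-range⁻ (∈-points⁻ v∈ i)))) kN<) ⟩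
        l                                   ∎
      -- The leftover `B` contains at most half of `A`, so the disjoint corners cover the other
      -- half.
      half : ∀ {q} → q ∈ qs → length A ≤ 2 * suc k * length (F q)
      half {q} q∈ with family q
      ... | F , B , _ , _ , uniqB , B⊆ , ¬corner , size = +-cancelʳ-≤ (length A) _ _ (begin
        length A + length A
          ≤⟨ +-mono-≤ size size ⟩
        length F * suc k + length B + (length F * suc k + length B)
          ≡⟨ eq (length F) (suc k) (length B) ⟩
        2 * suc k * length F + 2 * length B
          ≤⟨ +-monoʳ-≤ (2 * suc k * length F) (<⇒≤ (≤-<-trans (*-monoʳ-≤ 2 B≤) large)) ⟩
        2 * suc k * length F + length A ∎)
        where
        eq : ∀ f s b → f * s + b + (f * s + b) ≡ 2 * s * f + 2 * b
        eq = solve-∀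
        B≤ : length B ≤ (2 * Q) ^ k * c k M
        B≤ = Dilation.¬QCorner⇒length≤ k M Q q {{>-nonZero 0<M}} {{>-nonZero (proj₁ (qs-bounds q∈))}} (proj₂ (qs-bounds q∈)) uniqB
               (λ {z} z∈ → subst (λ N → z ∈ points k N) N≡ (sub (B⊆ z∈)))
               (subst (λ N → ¬ QCorner N q B) N≡ ¬corner)
      size : length qs * length A ≤ 2 * suc k * length H
      size = begin
        length qs * length A                          ≡⟨ sym (∑-const qs (length A)) ⟩
        ∑ qs (λ _ → length A)                         ≤⟨ ∑-mono qs half ⟩
        ∑ qs (λ q → 2 * suc k * length (F q))         ≡⟨ ∑-*ˡ qs (2 * suc k) _ ⟩
        2 * suc k * ∑ qs (λ q → length (F q))         ≡⟨ cong (2 * suc k *_) (trans (∑-cong qs (λ q → length≡∑ (F q)))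
                                                           (trans (sym (∑-H _)) (sym (length≡∑ H)))) ⟩
        2 * suc k * length H                          ∎

-- Scales between which the density hardly drops.

-- Otherwise the ratio f/g would drop by a factor 2^(2r+1) at each of the J steps from J to 2J,
-- contradicting f/g ≥ 2^(-2rJ) at 2J.
slow-step : ∀ (f g : ℕ → ℕ) r → (∀ j → f j ≤ g j) → (∀ j → 0 < g j) →
  (∀ j → 0 < j → g j ≤ 2 ^ (r * j) * f j) →
  ∀ J → 0 < J → ∃[ j ] J ≤ j × f j * g (suc j) ≤ 2 ^ suc (2 * r) * f (suc j) * g j
slow-step f g r f≤g g>0 g≤ J 0<J with search J
  where
  D = suc (2 * r)
  search : ∀ i → (∃[ j ] J ≤ j × f j * g (suc j) ≤ 2 ^ D * f (suc j) * g j)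
    ⊎ f (i + J) * 2 ^ (i * D) * g J ≤ f J * g (i + J)
  search zero    = inj₂ (≤-reflexive (cong (_* g J) (*-identityʳ (f J))))
  search (suc i) with search i
  ... | inj₁ found = inj₁ found
  ... | inj₂ le with f (i + J) * g (suc i + J) ≤? 2 ^ D * f (suc i + J) * g (i + J)
  ...   | yes slow = inj₁ (i + J , m≤n+m J i , slow)
  ...   | no fast  = inj₂ (*-cancelʳ-≤ _ _ (g (i + J)) {{>-nonZero (g>0 (i + J))}} (begin
    f (suc i + J) * 2 ^ (D + i * D) * g J * g (i + J)
      ≡⟨ cong (λ z → f (suc i + J) * z * g J * g (i + J)) (^-distribˡ-+-* 2 D (i * D)) ⟩
    f (suc i + J) * (2 ^ D * 2 ^ (i * D)) * g J * g (i + J)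
      ≡⟨ eq₁ (f (suc i + J)) (2 ^ D) (2 ^ (i * D)) (g J) (g (i + J)) ⟩
    2 ^ (i * D) * g J * (2 ^ D * f (suc i + J) * g (i + J))
      ≤⟨ *-monoʳ-≤ (2 ^ (i * D) * g J) (≰⇒≥ fast) ⟩
    2 ^ (i * D) * g J * (f (i + J) * g (suc i + J))
      ≡⟨ eq₂ (2 ^ (i * D)) (g J) (f (i + J)) (g (suc i + J)) ⟩
    f (i + J) * 2 ^ (i * D) * g J * g (suc i + J)
      ≤⟨ *-monoˡ-≤ (g (suc i + J)) le ⟩
    f J * g (i + J) * g (suc i + J)
      ≡⟨ eq₃ (f J) (g (i + J)) (g (suc i + J)) ⟩
    f J * g (suc i + J) * g (i + J) ∎))
    where
    open ≤-Reasoning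
    eq₁ : ∀ a b c d e → a * (b * c) * d * e ≡ c * d * (b * a * e)
    eq₁ = solve-∀
    eq₂ : ∀ a b c d → a * b * (c * d) ≡ c * a * b * d
    eq₂ = solve-∀
    eq₃ : ∀ a b c → a * b * c ≡ a * c * b
    eq₃ = solve-∀
... | inj₁ found = found
... | inj₂ le = contradiction exponents (<⇒≱ (≤-trans (n<1+n _) (≤-trans (+-monoˡ-≤ (r * (J + J)) 0<J) (≤-reflexive (eq J r)))))
  where
  open ≤-Reasoning
  D = suc (2 * r)
  eq : ∀ J r → J + r * (J + J) ≡ J * suc (2 * r)
  eq = solve-∀
  f>0 : 0 < f (J + J)
  f>0 = n≢0⇒n>0 λ f≡0 → <⇒≱ (g>0 (J + J)) (≤-trans (g≤ (J + J) (≤-trans 0<J (m≤m+n J J)))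
    (≤-reflexive (trans (cong (2 ^ (r * (J + J)) *_) f≡0) (*-zeroʳ (2 ^ (r * (J + J)))))))
  exponents : J * D ≤ r * (J + J)
  exponents = 2^-cancel-≤ (*-cancelʳ-≤ _ _ (f (J + J)) {{>-nonZero f>0}} (begin
    2 ^ (J * D) * f (J + J)          ≡⟨ *-comm (2 ^ (J * D)) _ ⟩
    f (J + J) * 2 ^ (J * D)          ≤⟨ *-cancelʳ-≤ _ _ (g J) {{>-nonZero (g>0 J)}}
                                          (≤-trans le (≤-trans (*-monoˡ-≤ (g (J + J)) (f≤g J)) (≤-reflexive (*-comm (g J) _)))) ⟩
    g (J + J)                        ≤⟨ g≤ (J + J) (≤-trans 0<J (m≤m+n J J)) ⟩
    2 ^ (r * (J + J)) * f (J + J)    ∎))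

-- Choice of the parameters.

module _ (k N : ℕ) where
  open Containers {Vec ℕ k} _≟V_ (CornerFree N) (cornerFree? N) (cornerFree-antitone N)

  -- Supersaturation in powers of two: with 2^x moduli there are at least 2^x |A| / (2(k+1)) edges,
  -- where |A| > X ≥ 2^(ν-a) and 2(k+1) ≤ 2^(k+1).
  corner-hypergraph : ∀ x ν a w {M Q l X} → 0 < M → N ≡ Q * M → k * N < 2 ^ l →
    2 ^ (x + x + 4) ≤ Q → 2 * ((2 * Q) ^ k * c k M) ≤ X → 2 ^ ν ≤ 2 ^ a * X →
    a + suc k + w ≡ x + ν →
    ∀ {A} → Unique A → A ⊆ points k N → X < length A → ∃[ H ]
    Hypergraph A [] (suc k) H × (∀ v → deg H v ≤ 2 ^ x) ×
    (∀ {u v} → u ≢ v → codeg H u v ≤ l) × 2 ^ w ≤ length H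
  corner-hypergraph x ν a w {M} {Q} {l} {X} 0<M N≡ kN< moduli≤Q dense 2^ν≤ exponents {A} uniq sub X<A
    = from-moduli (sparse-moduli x)
    where
    from-moduli : ∃[ qs ] length qs ≡ 2 ^ x ×
      (∀ {q} → q ∈ qs → 0 < q × q ≤ 2 ^ (x + x + 4)) ×
      (∀ {d l} → 0 < d → d < 2 ^ l → ∑ qs (λ q → ⟦ q ∣? d ⟧) ≤ l) →
      ∃[ H ] Hypergraph A [] (suc k) H × (∀ v → deg H v ≤ 2 ^ x) ×
        (∀ {u v} → u ≢ v → codeg H u v ≤ l) × 2 ^ w ≤ length H
    from-moduli (qs , length-qs , qs-bounds , qs-sparse) = from-supersaturation
      (Supersaturation.supersaturated k N {M} {Q} {l} {qs} 0<M N≡ kN<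
        (λ q∈ → let 0<q , q≤ = qs-bounds q∈ in 0<q , ≤-trans q≤ moduli≤Q)
        qs-sparse uniq sub (≤-<-trans dense X<A))
      where
      open ≤-Reasoning
      eq : ∀ a b c → a * (b * c) ≡ b * (a * c)
      eq = solve-∀
      from-supersaturation : ∃[ H ] Hypergraph A [] (suc k) H × (∀ v → deg H v ≤ length qs) ×
          (∀ {u v} → u ≢ v → codeg H u v ≤ l) × length qs * length A ≤ 2 * suc k * length H →
        ∃[ H ] Hypergraph A [] (suc k) H × (∀ v → deg H v ≤ 2 ^ x) ×
          (∀ {u v} → u ≢ v → codeg H u v ≤ l) × 2 ^ w ≤ length H
      from-supersaturation (H , hyp , deg≤ , codeg≤ , size) = H , hyp
        , (λ v → ≤-trans (deg≤ v) (≤-reflexive length-qs)) , codeg≤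
        , *-cancelˡ-≤ (2 ^ (a + suc k)) {{m^n≢0 2 (a + suc k)}} (begin
          2 ^ (a + suc k) * 2 ^ w
            ≡⟨ trans (2^-+ (a + suc k) w) (trans (cong (2 ^_) exponents) (sym (2^-+ x ν))) ⟩
          2 ^ x * 2 ^ ν
            ≤⟨ *-monoʳ-≤ (2 ^ x) (≤-trans 2^ν≤ (*-monoʳ-≤ (2 ^ a) (<⇒≤ X<A))) ⟩
          2 ^ x * (2 ^ a * length A)
            ≡⟨ eq (2 ^ x) (2 ^ a) (length A) ⟩
          2 ^ a * (2 ^ x * length A)
            ≤⟨ *-monoʳ-≤ (2 ^ a) (≤-trans (≤-reflexive (cong (_* length A) (sym length-qs))) size) ⟩
          2 ^ a * (2 * suc k * length H)
            ≤⟨ *-monoʳ-≤ (2 ^ a) (*-monoˡ-≤ (length H) (*-monoʳ-≤ 2 (n<2^n k))) ⟩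
          2 ^ a * (2 ^ suc k * length H)
            ≡⟨ trans (sym (*-assoc (2 ^ a) (2 ^ suc k) (length H))) (cong (_* length H) (2^-+ a (suc k))) ⟩
          2 ^ (a + suc k) * length H ∎)

-- The part of ν - σ that depends on k alone: k + 1 rounds lose k + 3 each, p contributes k + 1
-- besides 7m, and the last 2 comes from the relation required by `rounds`.
slack : ℕ → ℕ
slack k = (k + 1) * (k + 3) + k + 3

module Counting (k m M Q D : ℕ) (2≤k : 2 ≤ k) (m≥ : slack k + 20 ≤ m) (0<M : 0 < M)
  (N≡ : 2 ^ (m * m) ≡ Q * M) (Q≥ : 2 ^ ((38 * k + 59) * m) ≤ Q)
  (slow : c k M * (2 ^ (m * m)) ^ k ≤ 2 ^ D * c k (2 ^ (m * m)) * M ^ k) where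

  open ≤-Reasoning

  -- 2^ν points; hypergraphs of maximum degree 2^x, density 2^(-p) and codegrees at most l ≤ 2^ω₀;
  -- 2^(ν-θ) vertices chosen in each round; containers of size X; each application of the container
  -- algorithm removes a proportion 1 / steps of all points.
  N ν p s θ ω₀ l x X steps : ℕ
  N     = 2 ^ (m * m)
  ν     = m * m * k
  p     = 7 * m + k + 1
  s     = slack k
  θ     = 18 * m + s
  ω₀    = 2 * m
  l     = m * m + k
  x     = ω₀ + suc k * (θ + 1) + p + 1
  X     = 2 ^ (k + D + 1) * c k N
  steps = 2 ^ (7 * m + s)

  open Containers {Vec ℕ k} _≟V_ (CornerFree N) (cornerFree? N) (cornerFree-antitone N)
  open Rounds {Vec ℕ k} _≟V_ (CornerFree N) (cornerFree? N) (cornerFree-antitone N)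

  k+3≤s : k + 3 ≤ s
  k+3≤s = ≤-trans (m≤n+m (k + 3) ((k + 1) * (k + 3))) (≤-reflexive (sym (+-assoc ((k + 1) * (k + 3)) k 3)))

  s+20≤m : s + 20 ≤ m
  s+20≤m = m≥

  k+23≤m : k + 23 ≤ m
  k+23≤m = ≤-trans (≤-reflexive (eq k)) (≤-trans (+-monoˡ-≤ 20 k+3≤s) s+20≤m)
    where
    eq : ∀ k → k + 23 ≡ k + 3 + 20
    eq = solve-∀

  k<m : k < m
  k<m = ≤-trans (≤-trans (≤-reflexive (+-comm 1 k)) (+-monoʳ-≤ k (s≤s z≤n))) k+23≤m

  0<m : 0 < m
  0<m = ≤-<-trans z≤n k<m

  -- Makes the exponents τ = ν - θ and σ = ν - 7m - s natural numbers.
  19m+s≤ν : 18 * m + s ≤ ν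
  19m+s≤ν = begin
    18 * m + s    ≤⟨ +-monoʳ-≤ (18 * m) (≤-trans (m≤m+n s 20) s+20≤m) ⟩
    18 * m + m    ≡⟨ +-comm (18 * m) m ⟩
    19 * m        ≤⟨ *-monoˡ-≤ m (≤-trans (≤-trans (n≤1+n 19) (m≤n+m 20 s)) s+20≤m) ⟩
    m * m         ≤⟨ m≤m*n (m * m) k {{>-nonZero (≤-trans (s≤s z≤n) 2≤k)}} ⟩
    ν             ∎

  2^ν≤ : 2 ^ ν ≤ 2 ^ (7 * m) * c k N
  2^ν≤ = ≤-trans (≤-reflexive (sym (^-*-assoc 2 (m * m) k))) (N^k≤2^*c k m 2≤k 0<m)

  c≤X : c k N ≤ X
  c≤X = m≤n*m (c k N) (2 ^ (k + D + 1)) {{m^n≢0 2 (k + D + 1)}}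

  k+1≤2^k : suc k ≤ 2 ^ k
  k+1≤2^k = n<2^n k

  codeg-bound≤ : l ≤ 2 ^ ω₀
  codeg-bound≤ = begin
    m * m + k           ≤⟨ +-monoʳ-≤ (m * m) (<⇒≤ k<m) ⟩
    m * m + m           ≡⟨ eq m ⟩
    m * suc m           ≤⟨ *-mono-≤ (<⇒≤ (n<2^n m)) (n<2^n m) ⟩
    2 ^ m * 2 ^ m       ≡⟨ trans (2^-+ m m) (cong (2 ^_) (cong (m +_) (sym (+-identityʳ m)))) ⟩
    2 ^ (2 * m)         ∎
    where
    eq : ∀ m → m * m + m ≡ m * suc m
    eq = solve-∀

  kN< : k * N < 2 ^ l
  kN< = begin-strict
    k * N          <⟨ *-monoˡ-< N {{m^n≢0 2 (m * m)}} (n<2^n k) ⟩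
    2 ^ k * N      ≡⟨ trans (2^-+ k (m * m)) (cong (2 ^_) (+-comm k (m * m))) ⟩
    2 ^ l          ∎

  -- Origin of β: s + 1 and k + 2 are each absorbed by one m, so x ≤ 2m + 19(k+1)m + 8m = (19k+29)m,
  -- and the final 4 is absorbed by a further m.
  moduli≤Q : x + x + 4 ≤ (38 * k + 59) * m
  moduli≤Q = begin
    x + x + 4
      ≤⟨ +-monoˡ-≤ 4 (+-mono-≤ x≤ x≤) ⟩
    (19 * k + 29) * m + (19 * k + 29) * m + 4
      ≤⟨ +-monoʳ-≤ ((19 * k + 29) * m + (19 * k + 29) * m) (≤-trans (≤-trans (m≤m+n 4 19) (m≤n+m 23 k)) k+23≤m) ⟩
    (19 * k + 29) * m + (19 * k + 29) * m + m
      ≡⟨ eq k m ⟩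
    (38 * k + 59) * m ∎
    where
    eq : ∀ k m → (19 * k + 29) * m + (19 * k + 29) * m + m ≡ (38 * k + 59) * m
    eq = solve-∀
    x≤ : x ≤ (19 * k + 29) * m
    x≤ = begin
      2 * m + suc k * (18 * m + s + 1) + (7 * m + k + 1) + 1
        ≡⟨ eq₁ k m s ⟩
      2 * m + suc k * (18 * m + (s + 1)) + 7 * m + (k + 2)
        ≤⟨ +-mono-≤ (+-monoˡ-≤ (7 * m) (+-monoʳ-≤ (2 * m) (*-monoʳ-≤ (suc k) (+-monoʳ-≤ (18 * m)
             (≤-trans (+-monoʳ-≤ s (m≤m+n 1 19)) s+20≤m)))))
             (≤-trans (+-monoʳ-≤ k (m≤m+n 2 21)) k+23≤m) ⟩
      2 * m + suc k * (18 * m + m) + 7 * m + m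
        ≡⟨ eq₂ k m ⟩
      (19 * k + 29) * m ∎
      where
      eq₁ : ∀ k m s → 2 * m + suc k * (18 * m + s + 1) + (7 * m + k + 1) + 1
                    ≡ 2 * m + suc k * (18 * m + (s + 1)) + 7 * m + (k + 2)
      eq₁ = solve-∀
      eq₂ : ∀ k m → 2 * m + suc k * (18 * m + m) + 7 * m + m ≡ (19 * k + 29) * m
      eq₂ = solve-∀

  -- With N = Q M, `slow` says that c_k(M) Q^k ≤ 2^D c_k(N). The exponent k + D + 1 in `X` also pays
  -- for (2Q)^k in place of Q^k and for the requirement that leftovers be at most half of the set.
  dense : 2 * ((2 * Q) ^ k * c k M) ≤ X
  dense = begin
    2 * ((2 * Q) ^ k * c k M)       ≡⟨ cong (λ z → 2 * (z * c k M)) (^-distribʳ-* k 2 Q) ⟩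
    2 * (2 ^ k * Q ^ k * c k M)     ≡⟨ eq₁ (2 ^ k) (Q ^ k) (c k M) ⟩
    2 ^ k * 2 * (c k M * Q ^ k)     ≤⟨ *-monoʳ-≤ (2 ^ k * 2) cancelled ⟩
    2 ^ k * 2 * (2 ^ D * c k N)     ≡⟨ eq₂ (2 ^ k) (2 ^ D) (c k N) ⟩
    2 ^ k * 2 ^ D * 2 * c k N       ≡⟨ cong (_* c k N) (trans (cong (_* 2) (2^-+ k D)) (2^-+ (k + D) 1)) ⟩
    X                               ∎
    where
    eq₁ : ∀ a b c → 2 * (a * b * c) ≡ a * 2 * (c * b)
    eq₁ = solve-∀
    eq₂ : ∀ a d c → a * 2 * (d * c) ≡ a * d * 2 * c
    eq₂ = solve-∀
    ^-distribʳ-* : ∀ k a b → (a * b) ^ k ≡ a ^ k * b ^ k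
    ^-distribʳ-* zero    a b = refl
    ^-distribʳ-* (suc k) a b = trans (cong (a * b *_) (^-distribʳ-* k a b)) (eq a b (a ^ k) (b ^ k))
      where
      eq : ∀ a b x y → a * b * (x * y) ≡ a * x * (b * y)
      eq = solve-∀
    cancelled : c k M * Q ^ k ≤ 2 ^ D * c k N
    cancelled = *-cancelʳ-≤ _ _ (M ^ k) {{m^n≢0 M k {{>-nonZero 0<M}}}} (begin
      c k M * Q ^ k * M ^ k       ≡⟨ *-assoc (c k M) (Q ^ k) (M ^ k) ⟩
      c k M * (Q ^ k * M ^ k)     ≡⟨ cong (c k M *_) (trans (sym (^-distribʳ-* k Q M)) (cong (_^ k) (sym N≡))) ⟩
      c k M * N ^ k               ≤⟨ slow ⟩
      2 ^ D * c k N * M ^ k       ∎)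

  hypergraph : ∀ {A} → Unique A → A ⊆ points k N → X < length A → ∃[ H ]
    Hypergraph A [] (suc k) H ×
    (∀ v → deg H v ≤ 2 ^ x) ×
    (∀ {u v} → u ≢ v → codeg H u v ≤ l) ×
    2 ^ (ω₀ + suc k * (θ + 1) + 1 + ν) ≤ length H
  hypergraph = corner-hypergraph k N x ν (7 * m) (ω₀ + suc k * (θ + 1) + 1 + ν) 0<M N≡ kN<
    (≤-trans (2^-mono moduli≤Q) Q≥) dense
    (≤-trans 2^ν≤ (*-monoʳ-≤ (2 ^ (7 * m)) c≤X))
    (eq (7 * m) k ω₀ (suc k * (θ + 1)) ν)
    where
    eq : ∀ a k ω r ν → a + suc k + (ω + r + 1 + ν) ≡ ω + r + (a + k + 1) + 1 + ν
    eq = solve-∀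

  -- The selections of all runs cost at most `c k N` bits. Origin of θ = 18m + s: 7m for the density
  -- of c_k(N), 3m for ν + 1, m for k + 1, and 7m + s for the number of runs.
  fingerprints : ∀ τ → ν ≡ τ + θ → suc ν * 2 ^ τ * suc k * steps ≤ c k N
  fingerprints τ ν≡ = *-cancelˡ-≤ (2 ^ (7 * m)) {{m^n≢0 2 (7 * m)}} (begin
    2 ^ (7 * m) * (suc ν * 2 ^ τ * suc k * steps)
      ≡⟨ eq₁ (2 ^ (7 * m)) (suc ν) (2 ^ τ) (suc k) steps ⟩
    suc ν * suc k * (2 ^ (7 * m) * 2 ^ τ * steps)
      ≤⟨ *-monoˡ-≤ (2 ^ (7 * m) * 2 ^ τ * steps) (*-mono-≤ ν<  (≤-trans k<m (<⇒≤ (n<2^n m)))) ⟩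
    2 ^ (m + m + m) * 2 ^ m * (2 ^ (7 * m) * 2 ^ τ * 2 ^ (7 * m + s))
      ≡⟨ cong₂ _*_ (2^-+ (m + m + m) m) (trans (cong (_* 2 ^ (7 * m + s)) (2^-+ (7 * m) τ)) (2^-+ (7 * m + τ) (7 * m + s))) ⟩
    2 ^ (m + m + m + m) * 2 ^ (7 * m + τ + (7 * m + s))
      ≡⟨ trans (2^-+ (m + m + m + m) _) (cong (2 ^_) (trans (eq₂ m τ s) (sym ν≡))) ⟩
    2 ^ ν
      ≤⟨ 2^ν≤ ⟩
    2 ^ (7 * m) * c k N ∎)
    where
    eq₁ : ∀ a b c d e → a * (b * c * d * e) ≡ b * d * (a * c * e)
    eq₁ = solve-∀
    eq₂ : ∀ m τ s → m + m + m + m + (7 * m + τ + (7 * m + s)) ≡ τ + (18 * m + s)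
    eq₂ = solve-∀
    ν< : suc ν ≤ 2 ^ (m + m + m)
    ν< = begin
      suc (m * m * k)               ≤⟨ s≤s (*-mono-≤ (*-mono-≤ (<⇒≤ (n<2^n m)) (<⇒≤ (n<2^n m))) (<⇒≤ k<m)) ⟩
      suc (2 ^ m * 2 ^ m * m)       ≤⟨ +-monoˡ-≤ (2 ^ m * 2 ^ m * m) (*-mono-≤ (2^>0 m) (2^>0 m)) ⟩
      2 ^ m * 2 ^ m + 2 ^ m * 2 ^ m * m ≡⟨ sym (*-suc (2 ^ m * 2 ^ m) m) ⟩
      2 ^ m * 2 ^ m * suc m         ≤⟨ *-monoʳ-≤ (2 ^ m * 2 ^ m) (n<2^n m) ⟩
      2 ^ m * 2 ^ m * 2 ^ m         ≡⟨ trans (cong (_* 2 ^ m) (2^-+ m m)) (2^-+ (m + m) m) ⟩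
      2 ^ (m + m + m)               ∎

  -- The constant in the exponent is 1 for the selections plus 2^(k+D+1) for the subsets of a
  -- container of size `X`.
  numCornerFree≤-exponents : ∀ τ σ → θ + τ ≡ ν → 7 * m + s + σ ≡ ν →
    numCornerFree k N ≤ 2 ^ (suc (2 ^ (k + D + 1)) * c k N)
  numCornerFree≤-exponents τ σ τ-eq σ-eq = begin
    numCornerFree k N
      ≤⟨ numCornerFree≤cnt k N ⟩
    cnt (points k N) []
      ≤⟨ iterated-containers {points k N} {l} {suc k} {k} {ν} {σ} {τ} {θ} {ω₀} {p} {X}
           points≤ ν≡τ+θ codeg-bound≤ k+1≤2^k ν≡σ+ (unique-points k N) hypergraph
           steps (unique-points k N) id enough ⟩
    ((suc (2 ^ ν) ^ (2 ^ τ)) ^ suc k) ^ steps * 2 ^ X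
      ≤⟨ *-monoˡ-≤ (2 ^ X) (^-monoˡ-≤ steps (^-monoˡ-≤ (suc k) (^-monoˡ-≤ (2 ^ τ)
           (≤-trans (+-monoˡ-≤ (2 ^ ν) (2^>0 ν)) (≤-reflexive (2^-double ν)))))) ⟩
    (((2 ^ suc ν) ^ (2 ^ τ)) ^ suc k) ^ steps * 2 ^ X
      ≡⟨ cong (_* 2 ^ X) (trans (cong (λ z → (z ^ suc k) ^ steps) (^-*-assoc 2 (suc ν) (2 ^ τ)))
           (trans (cong (_^ steps) (^-*-assoc 2 (suc ν * 2 ^ τ) (suc k))) (^-*-assoc 2 (suc ν * 2 ^ τ * suc k) steps))) ⟩
    2 ^ (suc ν * 2 ^ τ * suc k * steps) * 2 ^ X
      ≤⟨ *-monoˡ-≤ (2 ^ X) (2^-mono (fingerprints τ ν≡τ+θ)) ⟩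
    2 ^ c k N * 2 ^ X
      ≡⟨ 2^-+ (c k N) X ⟩
    2 ^ (suc (2 ^ (k + D + 1)) * c k N) ∎
    where
    ν≡τ+θ : ν ≡ τ + θ
    ν≡τ+θ = trans (sym τ-eq) (+-comm θ τ)
    ν≡σ+ : ν ≡ σ + suc k * (k + 3) + p + 2
    ν≡σ+ = trans (sym σ-eq) (eq m k σ)
      where
      eq : ∀ m k σ → 7 * m + ((k + 1) * (k + 3) + k + 3) + σ ≡ σ + suc k * (k + 3) + (7 * m + k + 1) + 2
      eq = solve-∀
    length≡2^ν : length (points k N) ≡ 2 ^ ν
    length≡2^ν = trans (length-points k N) (^-*-assoc 2 (m * m) k)
    points≤ : length (points k N) ≤ 2 ^ ν
    points≤ = ≤-reflexive length≡2^ν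
    -- The runs suffice to discard the whole grid, as `steps` times 2^σ is 2^ν.
    enough : length (points k N) ≤ X + steps * 2 ^ σ
    enough = ≤-trans (≤-reflexive (trans length≡2^ν (trans (cong (2 ^_) (sym σ-eq)) (sym (2^-+ (7 * m + s) σ))))) (m≤n+m _ X)

  numCornerFree≤ : numCornerFree k N ≤ 2 ^ (suc (2 ^ (k + D + 1)) * c k N)
  numCornerFree≤ =
    let τ , τ-eq = m≤n⇒∃[o]m+o≡n 19m+s≤ν
        σ , σ-eq = m≤n⇒∃[o]m+o≡n (≤-trans (+-monoˡ-≤ s (*-monoˡ-≤ m (m≤m+n 7 11))) 19m+s≤ν)
    in numCornerFree≤-exponents τ σ τ-eq σ-eq

-- Applying the count at infinitely many scales.

theorem3 : (k : ℕ) → 2 ≤ k →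
    Σ ℕ (λ C → 0 < C × ((M : ℕ) → Σ ℕ (λ N → M < N × numCornerFree k N ≤ 2 ^ (C * c k N))))
theorem3 k 2≤k = suc (2 ^ (k + D + 1)) , s≤s z≤n , λ M₀ → infinitely-often M₀
  where
  open ≤-Reasoning
  β = 38 * k + 59
  0<β : 0 < β
  0<β = ≤-trans (s≤s z≤n) (m≤n+m 59 (38 * k))
  -- The drop allowed by `slow-step` at r = 7β, since the density at scale j is at least 2^(-7βj).
  D = suc (2 * (7 * β))
  size : ℕ → ℕ
  size j = 2 ^ (β * j * (β * j))
  density : ∀ j → 0 < j → size j ^ k ≤ 2 ^ (7 * β * j) * c k (size j)
  density j 0<j = ≤-trans (N^k≤2^*c k (β * j) 2≤k (*-mono-≤ 0<β 0<j))
    (≤-reflexive (cong (λ e → 2 ^ e * c k (size j)) (sym (*-assoc 7 β j))))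
  at-slow-step : ∀ M₀ j → M₀ + (slack k + 20) ≤ j →
    c k (size j) * size (suc j) ^ k ≤ 2 ^ D * c k (size (suc j)) * size j ^ k →
    Σ ℕ (λ N → M₀ < N × numCornerFree k N ≤ 2 ^ (suc (2 ^ (k + D + 1)) * c k N))
  at-slow-step M₀ j J≤j slow = size (suc j) , large
    , Counting.numCornerFree≤ k m (size j) (2 ^ (β * β * (2 * j + 1))) D 2≤k m≥ (2^>0 (β * j * (β * j))) N≡ (2^-mono Q≥) slow
    where
    m = β * suc j
    j<m : j < m
    j<m = m≤n*m (suc j) β {{>-nonZero 0<β}}
    m≥ : slack k + 20 ≤ m
    m≥ = ≤-trans (≤-trans (m≤n+m _ M₀) J≤j) (<⇒≤ j<m)
    large : M₀ < size (suc j)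
    large = begin-strict
      M₀              ≤⟨ ≤-trans (m≤m+n M₀ (slack k + 20)) J≤j ⟩
      j               <⟨ j<m ⟩
      m               ≤⟨ m≤m*n m m {{>-nonZero (≤-<-trans z≤n j<m)}} ⟩
      m * m           <⟨ n<2^n (m * m) ⟩
      2 ^ (m * m)     ∎
    N≡ : 2 ^ (m * m) ≡ 2 ^ (β * β * (2 * j + 1)) * size j
    N≡ = trans (cong (2 ^_) (eq β j)) (sym (2^-+ (β * β * (2 * j + 1)) (β * j * (β * j))))
      where
      eq : ∀ β j → β * suc j * (β * suc j) ≡ β * β * (2 * j + 1) + β * j * (β * j)
      eq = solve-∀
    -- Squares as exponents make consecutive scales differ by 2^(β²(2j+1)), which is at least
    -- 2^(βm); this is how a large β puts Q above any prescribed power of 2^m.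
    Q≥ : β * m ≤ β * β * (2 * j + 1)
    Q≥ = ≤-trans (≤-reflexive (sym (*-assoc β β (suc j)))) (*-monoʳ-≤ (β * β)
      (≤-trans (m≤m+n (suc j) j) (≤-reflexive (eq j))))
      where
      eq : ∀ j → suc j + j ≡ 2 * j + 1
      eq = solve-∀
  infinitely-often : ∀ M₀ → Σ ℕ (λ N → M₀ < N × numCornerFree k N ≤ 2 ^ (suc (2 ^ (k + D + 1)) * c k N))
  infinitely-often M₀ =
    -- Starting the search at `M₀ + (slack k + 20)` ensures both that N exceeds `M₀` and that m is
    -- large enough for `Counting`.
    let j , J≤j , slow = slow-step (λ j → c k (size j)) (λ j → size j ^ k) (7 * β)
          (λ j → c≤N^k k (size j)) (λ j → m^n>0 (size j) {{m^n≢0 2 (β * j * (β * j))}} k) density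
          (M₀ + (slack k + 20)) (≤-trans (≤-trans (s≤s z≤n) (m≤n+m 20 (slack k))) (m≤n+m _ M₀))
    in at-slow-step M₀ j J≤j slow
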